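{- Let $\Phi=(D,\varphi)$ be a $\mathbb{T}$-gain digraph whose underlying digraph $D$ is strongly connected. Then $\rho(\Phi)=\Delta^+$ if and only if $D$ is $\Delta^+$-out-regular and $\Phi$ is $\mu$-balanced for some $\mu\in\mathbb{T}$.
   Context: A digraph $D=(V,\mathcal{A})$ has a finite vertex set $V=\{v_1,\dots,v_n\}$ and a set $\mathcal{A}$ of ordered pairs of distinct vertices, called arcs (no loops; at most one arc from $v_i$ to $v_j$ for each ordered pair; opposite arcs may both be present). The out-degree $\deg^+(v)$ is the number of arcs leaving $v$, and $\Delta^+=\max_i\deg^+(v_i)$; $D$ is $\Delta^+$-out-regular if $\deg^+(v)=\Delta^+$ for every vertex $v$. A directed cycle is a closed directed walk whose vertices are distinct except that the first and last coincide (so its length is at least $2$; length $2$ is allowed). $D$ is strongly connected if every ordered pair of vertices is joined by a directed path. Let $\mathbb{T}=\{z\in\mathbb{C}:|z|=1\}$. A $\mathbb{T}$-gain digraph is a pair $\Phi=(D,\varphi)$ with $\varphi:\mathcal{A}\to\mathbb{T}$ an arbitrary function (no relation between gains of opposite arcs). Its gain adjacency matrix $A(\Phi)$ has entries $A(\Phi)_{ij}=\varphi(v_i,v_j)$ if $(v_i,v_j)\in\mathcal{A}$ and $0$ otherwise. $\rho(\Phi)$ is the spectral radius (maximum modulus of a complex eigenvalue) of $A(\Phi)$. The gain $\varphi(C)$ of a directed cycle is the product of the gains of its arcs. For $\mu\in\mathbb{T}$, $\Phi$ is $\mu$-balanced if $\varphi(C)=\mu^{|C|}$ for every directed cycle $C$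 of $D$, where $|C|$ is the length of $C$. -}

module Defs where

open import Algebra.Bundles.Raw using (RawSemiring)
import Algebra.Definitions.RawSemiring as RawSemiringDefs
open import Data.Bool.Base using (Bool; T)
open import Data.Bool.Properties using (T?)
open import Data.Empty using (⊥-elim)
open import Data.Fin.Base using (Fin)
open import Data.Fin.Subset using (Subset; ∣_∣)
import Data.Integer.Base as ℤ
import Data.Integer.Properties as ℤ
open import Data.List.Base as List using (List; []; _∷_; _∷ʳ_)
open import Data.List.Extrema.Nat using (max)
open import Data.List.Relation.Unary.Unique.Propositional using (Unique)
open import Data.Nat.Base as ℕ using (ℕ; zero; suc)
open import Data.Nat.Coprimality using (1-coprimeTo)
import Data.Nat.Properties as ℕ
import Data.Nat.Solver as ℕ
open import Data.Product using (Σ-syntax; ∃-syntax; _×_; _,_; proj₁; proj₂)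
open import Data.Rational.Base as ℚ using (ℚ; 0ℚ; 1ℚ; ½; mkℚ; toℚᵘ)
import Data.Rational.Properties as ℚ
import Data.Rational.Solver as ℚ
import Data.Rational.Unnormalised.Base as ℚᵘ
import Data.Rational.Unnormalised.Properties as ℚᵘ
open import Data.Sum.Base using (inj₁; inj₂)
import Data.Vec.Base as Vec
open import Data.Vec.Functional using (Vector)
open import Level using (0ℓ)
open import Relation.Binary.Construct.Closure.ReflexiveTransitive using (Star; _◅_) renaming (ε to stop)
open import Relation.Binary.PropositionalEquality
  using (_≡_; refl; sym; trans; cong; cong₂; subst; subst₂)
open import Relation.Nullary using (¬_; yes; no)

½ε>0 : ∀ {ε} → 0ℚ ℚ.< ε → 0ℚ ℚ.< ½ ℚ.* ε
½ε>0 {ε} ε>0 =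
  ℚ.positive⁻¹ (½ ℚ.* ε) {{ℚ.pos*pos⇒pos ½ ε {{ℚ.positive ε>0}}}}

½ε+½ε≡ε : ∀ ε → ½ ℚ.* ε ℚ.+ ½ ℚ.* ε ≡ ε
½ε+½ε≡ε ε = trans (sym (ℚ.*-distribʳ-+ ε ½ ½)) (ℚ.*-identityˡ ε)

∣p∣≤∣q∣+∣p-q∣ : ∀ p q → ℚ.∣ p ∣ ℚ.≤ ℚ.∣ q ∣ ℚ.+ ℚ.∣ p ℚ.- q ∣
∣p∣≤∣q∣+∣p-q∣ p q =
  subst (λ r → ℚ.∣ r ∣ ℚ.≤ ℚ.∣ q ∣ ℚ.+ ℚ.∣ p ℚ.- q ∣) (sym split) (ℚ.∣p+q∣≤∣p∣+∣q∣ q (p ℚ.- q))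
  where
  open ℚ.+-*-Solver
  split : p ≡ q ℚ.+ (p ℚ.- q)
  split = solve 2 (λ p q → p := q :+ (p :- q)) refl p q

*-mono-≤ : ∀ {p q r s} → 0ℚ ℚ.≤ r → 0ℚ ℚ.≤ q → p ℚ.≤ q → r ℚ.≤ s → p ℚ.* r ℚ.≤ q ℚ.* s
*-mono-≤ {p} {q} {r} {s} 0≤r 0≤q p≤q r≤s = ℚ.≤-trans
  (ℚ.*-monoʳ-≤-nonNeg r {{ℚ.nonNegative 0≤r}} p≤q)
  (ℚ.*-monoˡ-≤-nonNeg q {{ℚ.nonNegative 0≤q}} r≤s)

toℚᵘ-∣-∣ : ∀ q → toℚᵘ ℚ.∣ q ∣ ≡ ℚᵘ.mkℚᵘ (ℤ.+ ℤ.∣ ℚ.↥ q ∣) (ℚ.denominator-1 q)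
toℚᵘ-∣-∣ (mkℚ _ _ _) = refl

-- 1 / (1 + n)
unit : ℕ → ℚ
unit n = mkℚ (ℤ.+ 1) n (1-coprimeTo (suc n))

unit>0 : ∀ n → 0ℚ ℚ.< unit n
unit>0 n = ℚ.positive⁻¹ (unit n)

archimedean : ∀ ε → 0ℚ ℚ.< ε → ∃[ N ] ∀ n → N ℕ.≤ n → unit n ℚ.≤ ε
archimedean (mkℚ ℤ.+[1+ k ] d _) _ = d , λ n d≤n →
  ℚ.*≤* (ℤ.+≤+ (ℕ.≤-trans (ℕ.≤-reflexive (ℕ.+-identityʳ (suc d)))
    (ℕ.≤-trans (ℕ.s≤s d≤n) (ℕ.m≤m+n (suc n) (k ℕ.* suc n)))))
archimedean (mkℚ (ℤ.+ 0) d _) (ℚ.*<* (ℤ.+<+ ()))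
archimedean (mkℚ ℤ.-[1+ k ] d _) (ℚ.*<* ())

isqrt : ℕ → ℕ
isqrt zero = 0
isqrt (suc m) with suc (isqrt m) ℕ.* suc (isqrt m) ℕ.≤? suc m
... | yes _ = suc (isqrt m)
... | no  _ = isqrt m

isqrt-lower : ∀ m → isqrt m ℕ.* isqrt m ℕ.≤ m
isqrt-lower zero = ℕ.z≤n
isqrt-lower (suc m) with suc (isqrt m) ℕ.* suc (isqrt m) ℕ.≤? suc m
... | yes p = p
... | no  _ = ℕ.m≤n⇒m≤1+n (isqrt-lower m)

isqrt-upper : ∀ m → m ℕ.< suc (isqrt m) ℕ.* suc (isqrt m)
isqrt-upper zero = ℕ.s≤s ℕ.z≤n
isqrt-upper (suc m) with suc (isqrt m) ℕ.* suc (isqrt m) ℕ.≤? suc m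
... | yes _ = ℕ.≤-trans (ℕ.s≤s (isqrt-upper m))
                (ℕ.*-mono-< (ℕ.n<1+n (suc (isqrt m))) (ℕ.n<1+n (suc (isqrt m))))
... | no ¬p = ℕ.≰⇒> ¬p

module SqrtApprox (n : ℕ) (q : ℚ) where
  private
    a b N k D : ℕ
    a = ℤ.∣ ℚ.↥ q ∣
    b = ℚ.↧ₙ q
    N = suc n
    k = isqrt (a ℕ.* b ℕ.* (N ℕ.* N))
    D = b ℕ.* N

  -- With |q| = a / b this is ⌊ √(a b N²) ⌋ / (b N), the square root of |q|
  -- rounded down to the grid of step 1 / (b N).
  abstract
    sqrtApprox : ℚ
    sqrtApprox = (ℤ.+ k) ℚ./ (b ℕ.* N)

  private
    lowerℕ : k ℕ.* k ℕ.* b ℕ.≤ a ℕ.* (D ℕ.* D)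
    lowerℕ = ℕ.≤-trans (ℕ.*-monoˡ-≤ b (isqrt-lower (a ℕ.* b ℕ.* (N ℕ.* N))))
      (ℕ.≤-reflexive (solve 3 (λ a b N → a :* b :* (N :* N) :* b
                                      := a :* (b :* N :* (b :* N))) refl a b N))
      where open ℕ.+-*-Solver

    upperℕ : a ℕ.* ((D ℕ.* N) ℕ.* (D ℕ.* N))
             ℕ.≤ ((k ℕ.* N ℕ.+ 1 ℕ.* D) ℕ.* (k ℕ.* N ℕ.+ 1 ℕ.* D)) ℕ.* b
    upperℕ = begin
      a ℕ.* ((D ℕ.* N) ℕ.* (D ℕ.* N))
        ≡⟨ solve 3 (λ a b N → a :* ((b :* N :* N) :* (b :* N :* N))
             := a :* b :* (N :* N) :* (N :* N :* b)) refl a b N ⟩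
      a ℕ.* b ℕ.* (N ℕ.* N) ℕ.* (N ℕ.* N ℕ.* b)
        ≤⟨ ℕ.*-monoˡ-≤ (N ℕ.* N ℕ.* b) (ℕ.<⇒≤ (isqrt-upper (a ℕ.* b ℕ.* (N ℕ.* N)))) ⟩
      suc k ℕ.* suc k ℕ.* (N ℕ.* N ℕ.* b)
        ≤⟨ ℕ.*-monoˡ-≤ (N ℕ.* N ℕ.* b) (ℕ.*-mono-≤ k+1≤k+b k+1≤k+b) ⟩
      (k ℕ.+ b) ℕ.* (k ℕ.+ b) ℕ.* (N ℕ.* N ℕ.* b)
        ≡⟨ solve 3 (λ k b N → (k :+ b) :* (k :+ b) :* (N :* N :* b)
             := (k :* N :+ con 1 :* (b :* N)) :* (k :* N :+ con 1 :* (b :* N)) :* b)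
             refl k b N ⟩
      ((k ℕ.* N ℕ.+ 1 ℕ.* D) ℕ.* (k ℕ.* N ℕ.+ 1 ℕ.* D)) ℕ.* b ∎
      where
      open ℕ.+-*-Solver
      open ℕ.≤-Reasoning
      k+1≤k+b : suc k ℕ.≤ k ℕ.+ b
      k+1≤k+b = subst (ℕ._≤ k ℕ.+ b) (ℕ.+-comm k 1) (ℕ.+-monoʳ-≤ k (ℕ.s≤s ℕ.z≤n))

    sᵘ : ℚᵘ.ℚᵘ
    sᵘ = ℚᵘ.mkℚᵘ (ℤ.+ k) (ℕ.pred (b ℕ.* N))

    toℚᵘ-∣q∣ : toℚᵘ ℚ.∣ q ∣ ≡ ℚᵘ.mkℚᵘ (ℤ.+ a) (ℚ.denominator-1 q)
    toℚᵘ-∣q∣ = toℚᵘ-∣-∣ q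

    abstract
      toℚᵘ-s : toℚᵘ sqrtApprox ℚᵘ.≃ sᵘ
      toℚᵘ-s = ℚ.toℚᵘ-fromℚᵘ sᵘ

  abstract
    sqrtApprox≥0 : 0ℚ ℚ.≤ sqrtApprox
    sqrtApprox≥0 = ℚ.nonNegative⁻¹ sqrtApprox {{ℚ.normalize-nonNeg k (b ℕ.* N)}}

    sqrtApprox-lower : sqrtApprox ℚ.* sqrtApprox ℚ.≤ ℚ.∣ q ∣
    sqrtApprox-lower = ℚ.toℚᵘ-cancel-≤ (ℚᵘ.≤-trans
      (ℚᵘ.≤-reflexive (ℚᵘ.≃-trans (ℚ.toℚᵘ-homo-* sqrtApprox sqrtApprox)
                                  (ℚᵘ.*-cong toℚᵘ-s toℚᵘ-s)))
      (subst (sᵘ ℚᵘ.* sᵘ ℚᵘ.≤_) (sym toℚᵘ-∣q∣) (ℚᵘ.*≤* (subst₂ ℤ._≤_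
        (trans (ℤ.pos-* (k ℕ.* k) b) (cong (ℤ._* ℤ.+ b) (ℤ.pos-* k k)))
        (ℤ.pos-* a (D ℕ.* D))
        (ℤ.+≤+ lowerℕ)))))

    sqrtApprox-upper : ℚ.∣ q ∣ ℚ.≤ (sqrtApprox ℚ.+ unit n) ℚ.* (sqrtApprox ℚ.+ unit n)
    sqrtApprox-upper = ℚ.toℚᵘ-cancel-≤ (ℚᵘ.≤-trans
      (subst (ℚᵘ._≤ (sᵘ ℚᵘ.+ toℚᵘ (unit n)) ℚᵘ.* (sᵘ ℚᵘ.+ toℚᵘ (unit n))) (sym toℚᵘ-∣q∣) (ℚᵘ.*≤* (subst₂ ℤ._≤_
        (ℤ.pos-* a ((D ℕ.* N) ℕ.* (D ℕ.* N)))
        (trans (ℤ.pos-* (M ℕ.* M) b) (cong (ℤ._* ℤ.+ b) (trans (ℤ.pos-* M M) (cong₂ ℤ._*_ M≡ M≡))))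
        (ℤ.+≤+ upperℕ))))
      (ℚᵘ.≤-reflexive (ℚᵘ.≃-sym (ℚᵘ.≃-trans
         (ℚ.toℚᵘ-homo-* (sqrtApprox ℚ.+ unit n) (sqrtApprox ℚ.+ unit n))
         (ℚᵘ.*-cong s+u s+u)))))
      where
      M : ℕ
      M = k ℕ.* N ℕ.+ 1 ℕ.* D
      M≡ : ℤ.+ M ≡ ℤ.+ k ℤ.* ℤ.+ N ℤ.+ ℤ.+ 1 ℤ.* ℤ.+ D
      M≡ = cong₂ ℤ._+_ (ℤ.pos-* k N) (ℤ.pos-* 1 D)
      s+u : toℚᵘ (sqrtApprox ℚ.+ unit n) ℚᵘ.≃ sᵘ ℚᵘ.+ toℚᵘ (unit n)
      s+u = ℚᵘ.≃-trans (ℚ.toℚᵘ-homo-+ sqrtApprox (unit n))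
              (ℚᵘ.+-cong toℚᵘ-s ℚᵘ.≃-refl)

open SqrtApprox

∣p-q∣≤ε : ∀ {p q ε} → p ℚ.≤ q ℚ.+ ε → q ℚ.≤ p ℚ.+ ε → ℚ.∣ p ℚ.- q ∣ ℚ.≤ ε
∣p-q∣≤ε {p} {q} {ε} p≤q+ε q≤p+ε with ℚ.∣p∣≡p∨∣p∣≡-p (p ℚ.- q)
... | inj₁ eq = subst₂ ℚ._≤_ (sym eq)
  (solve 2 (λ q ε → q :+ ε :- q := ε) refl q ε) (ℚ.+-monoˡ-≤ (ℚ.- q) p≤q+ε)
  where open ℚ.+-*-Solver
... | inj₂ eq = subst₂ ℚ._≤_
  (trans (solve 2 (λ p q → q :- p := :- (p :- q)) refl p q) (sym eq))
  (solve 2 (λ p ε → p :+ ε :- p := ε) refl p ε) (ℚ.+-monoˡ-≤ (ℚ.- p) q≤p+ε)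
  where open ℚ.+-*-Solver

square-cancel-≤ : ∀ {p q} → 0ℚ ℚ.≤ q → p ℚ.* p ℚ.≤ q ℚ.* q → p ℚ.≤ q
square-cancel-≤ {p} {q} 0≤q p²≤q² with p ℚ.≤? q
... | yes p≤q = p≤q
... | no  p≰q = ⊥-elim (ℚ.<-irrefl refl (ℚ.<-≤-trans q²<p² p²≤q²))
  where
  q<p : q ℚ.< p
  q<p = ℚ.≰⇒> p≰q
  q²<p² : q ℚ.* q ℚ.< p ℚ.* p
  q²<p² = ℚ.≤-<-trans (ℚ.*-monoˡ-≤-nonNeg q {{ℚ.nonNegative 0≤q}} (ℚ.<⇒≤ q<p))
    (ℚ.*-monoˡ-<-pos p {{ℚ.positive (ℚ.≤-<-trans 0≤q q<p)}} q<p)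

√-close : ∀ {s t u h p q d} → 0ℚ ℚ.≤ s → 0ℚ ℚ.≤ u → u ℚ.≤ h →
  t ℚ.* t ℚ.≤ q → q ℚ.≤ p ℚ.+ d → p ℚ.≤ (s ℚ.+ u) ℚ.* (s ℚ.+ u) → d ℚ.≤ h ℚ.* h →
  t ℚ.≤ s ℚ.+ (h ℚ.+ h)
√-close {s} {t} {u} {h} {p} {q} {d} s≥0 u≥0 u≤h t²≤q q≤p+d p≤ d≤h² = square-cancel-≤ s+2h≥0 (begin
  t ℚ.* t           ≤⟨ t²≤q ⟩
  q                 ≤⟨ q≤p+d ⟩
  p ℚ.+ d           ≤⟨ ℚ.+-mono-≤ p≤ d≤h² ⟩
  (s ℚ.+ u) ℚ.* (s ℚ.+ u) ℚ.+ h ℚ.* h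
    ≤⟨ ℚ.+-monoˡ-≤ (h ℚ.* h) (*-mono-≤ s+u≥0 s+h≥0 s+u≤s+h s+u≤s+h) ⟩
  (s ℚ.+ h) ℚ.* (s ℚ.+ h) ℚ.+ h ℚ.* h
    ≡⟨ ℚ.+-identityʳ _ ⟨
  (s ℚ.+ h) ℚ.* (s ℚ.+ h) ℚ.+ h ℚ.* h ℚ.+ 0ℚ
    ≤⟨ ℚ.+-monoʳ-≤ ((s ℚ.+ h) ℚ.* (s ℚ.+ h) ℚ.+ h ℚ.* h) (ℚ.+-mono-≤ r≥0 r≥0) ⟩
  (s ℚ.+ h) ℚ.* (s ℚ.+ h) ℚ.+ h ℚ.* h ℚ.+ (h ℚ.* (s ℚ.+ h) ℚ.+ h ℚ.* (s ℚ.+ h))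
    ≡⟨ solve 2 (λ s h → (s :+ h) :* (s :+ h) :+ h :* h :+ (h :* (s :+ h) :+ h :* (s :+ h))
                     := (s :+ (h :+ h)) :* (s :+ (h :+ h))) refl s h ⟩
  (s ℚ.+ (h ℚ.+ h)) ℚ.* (s ℚ.+ (h ℚ.+ h)) ∎)
  where
  open ℚ.+-*-Solver
  open ℚ.≤-Reasoning
  h≥0 : 0ℚ ℚ.≤ h
  h≥0 = ℚ.≤-trans u≥0 u≤h
  s+2h≥0 : 0ℚ ℚ.≤ s ℚ.+ (h ℚ.+ h)
  s+2h≥0 = ℚ.+-mono-≤ s≥0 (ℚ.+-mono-≤ h≥0 h≥0)
  s+u≥0 : 0ℚ ℚ.≤ s ℚ.+ u
  s+u≥0 = ℚ.+-mono-≤ s≥0 u≥0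
  s+h≥0 : 0ℚ ℚ.≤ s ℚ.+ h
  s+h≥0 = ℚ.+-mono-≤ s≥0 h≥0
  s+u≤s+h : s ℚ.+ u ℚ.≤ s ℚ.+ h
  s+u≤s+h = ℚ.+-monoʳ-≤ s u≤h
  r≥0 : 0ℚ ℚ.≤ h ℚ.* (s ℚ.+ h)
  r≥0 = *-mono-≤ {0ℚ} {h} {0ℚ} ℚ.≤-refl h≥0 h≥0 s+h≥0

sqrtApprox-close : ∀ {ε} m n p q → unit m ℚ.≤ ½ ℚ.* ε →
  ℚ.∣ q ℚ.- p ∣ ℚ.≤ (½ ℚ.* ε) ℚ.* (½ ℚ.* ε) →
  sqrtApprox n q ℚ.≤ sqrtApprox m p ℚ.+ ε
sqrtApprox-close {ε} m n p q u≤h q-p≤h² =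
  subst (λ e → sqrtApprox n q ℚ.≤ sqrtApprox m p ℚ.+ e) (½ε+½ε≡ε ε)
    (√-close (sqrtApprox≥0 m p) (ℚ.<⇒≤ (unit>0 m)) u≤h (sqrtApprox-lower n q)
             (∣p∣≤∣q∣+∣p-q∣ q p) (sqrtApprox-upper m p) q-p≤h²)

Cauchy : (ℕ → ℚ) → Set
Cauchy f = ∀ ε → 0ℚ ℚ.< ε →
  ∃[ N ] ∀ m n → N ℕ.≤ m → N ℕ.≤ n → ℚ.∣ f m ℚ.- f n ∣ ℚ.≤ ε

-- Reals are Cauchy sequences of rationals, with _≈ᴿ_ as their equality.
record ℝ : Set where
  constructor mkℝ
  field
    seq    : ℕ → ℚ
    cauchy : Cauchy seq
open ℝ public

infix 4 _≈ᴿ_ _≤ᴿ_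

_≈ᴿ_ : ℝ → ℝ → Set
x ≈ᴿ y = ∀ ε → 0ℚ ℚ.< ε → ∃[ N ] ∀ n → N ℕ.≤ n → ℚ.∣ seq x n ℚ.- seq y n ∣ ℚ.≤ ε

_≤ᴿ_ : ℝ → ℝ → Set
x ≤ᴿ y = ∀ ε → 0ℚ ℚ.< ε → ∃[ N ] ∀ n → N ℕ.≤ n → seq x n ℚ.≤ seq y n ℚ.+ ε

fromℚ : ℚ → ℝ
fromℚ q = mkℝ (λ _ → q) λ ε ε>0 → 0 , λ _ _ _ _ →
  subst (λ d → ℚ.∣ d ∣ ℚ.≤ ε) (sym (ℚ.+-inverseʳ q)) (ℚ.<⇒≤ ε>0)

fromℕ : ℕ → ℝ
fromℕ n = fromℚ ((ℤ.+ n) ℚ./ 1)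

0ᴿ 1ᴿ : ℝ
0ᴿ = fromℚ 0ℚ
1ᴿ = fromℚ 1ℚ

abstract
  cauchy-+ : ∀ f g → Cauchy f → Cauchy g → Cauchy (λ n → f n ℚ.+ g n)
  cauchy-+ f g cf cg ε ε>0 with cf (½ ℚ.* ε) (½ε>0 ε>0) | cg (½ ℚ.* ε) (½ε>0 ε>0)
  ... | M , close-f | N , close-g = M ℕ.⊔ N , λ m n M⊔N≤m M⊔N≤n → begin
    ℚ.∣ f m ℚ.+ g m ℚ.- (f n ℚ.+ g n) ∣
      ≡⟨ cong ℚ.∣_∣ (solve 4 (λ a b c d → a :+ b :- (c :+ d) := (a :- c) :+ (b :- d))
                     refl (f m) (g m) (f n) (g n)) ⟩
    ℚ.∣ (f m ℚ.- f n) ℚ.+ (g m ℚ.- g n) ∣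
      ≤⟨ ℚ.∣p+q∣≤∣p∣+∣q∣ (f m ℚ.- f n) (g m ℚ.- g n) ⟩
    ℚ.∣ f m ℚ.- f n ∣ ℚ.+ ℚ.∣ g m ℚ.- g n ∣
      ≤⟨ ℚ.+-mono-≤
           (close-f m n (ℕ.m⊔n≤o⇒m≤o M N M⊔N≤m) (ℕ.m⊔n≤o⇒m≤o M N M⊔N≤n))
           (close-g m n (ℕ.m⊔n≤o⇒n≤o M N M⊔N≤m) (ℕ.m⊔n≤o⇒n≤o M N M⊔N≤n)) ⟩
    ½ ℚ.* ε ℚ.+ ½ ℚ.* ε ≡⟨ ½ε+½ε≡ε ε ⟩
    ε ∎
    where
    open ℚ.+-*-Solver
    open ℚ.≤-Reasoning

  cauchy-neg : ∀ f → Cauchy f → Cauchy (λ n → ℚ.- f n)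
  cauchy-neg f cf ε ε>0 with cf ε ε>0
  ... | N , close = N , λ m n N≤m N≤n → subst (ℚ._≤ ε)
    (trans (sym (ℚ.∣-p∣≡∣p∣ (f m ℚ.- f n)))
           (cong ℚ.∣_∣ (ℚ.neg-distrib-+ (f m) (ℚ.- f n))))
    (close m n N≤m N≤n)

  eventually-bounded : ∀ f → Cauchy f →
    ∃[ B ] 0ℚ ℚ.< B × ∃[ N ] ∀ n → N ℕ.≤ n → ℚ.∣ f n ∣ ℚ.≤ B
  eventually-bounded f cf with cf 1ℚ (ℚ.positive⁻¹ 1ℚ)
  ... | N , close =
    ℚ.∣ f N ∣ ℚ.+ 1ℚ , ℚ.+-mono-≤-< (ℚ.0≤∣p∣ (f N)) (ℚ.positive⁻¹ 1ℚ) , N , λ n N≤n →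
      ℚ.≤-trans (∣p∣≤∣q∣+∣p-q∣ (f n) (f N))
                (ℚ.+-monoʳ-≤ ℚ.∣ f N ∣ (close n N N≤n ℕ.≤-refl))

  product-close : ∀ {A B α β} a b c d → 0ℚ ℚ.≤ A → 0ℚ ℚ.≤ α →
    ℚ.∣ a ∣ ℚ.≤ A → ℚ.∣ d ∣ ℚ.≤ B → ℚ.∣ a ℚ.- c ∣ ℚ.≤ α → ℚ.∣ b ℚ.- d ∣ ℚ.≤ β →
    ℚ.∣ a ℚ.* b ℚ.- c ℚ.* d ∣ ℚ.≤ A ℚ.* β ℚ.+ α ℚ.* B
  product-close {A} {B} {α} {β} a b c d A≥0 α≥0 a≤A d≤B a-c≤α b-d≤β = begin
    ℚ.∣ a ℚ.* b ℚ.- c ℚ.* d ∣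
      ≡⟨ cong ℚ.∣_∣ (solve 4 (λ a b c d → a :* b :- c :* d := a :* (b :- d) :+ (a :- c) :* d)
                     refl a b c d) ⟩
    ℚ.∣ a ℚ.* (b ℚ.- d) ℚ.+ (a ℚ.- c) ℚ.* d ∣
      ≤⟨ ℚ.∣p+q∣≤∣p∣+∣q∣ (a ℚ.* (b ℚ.- d)) ((a ℚ.- c) ℚ.* d) ⟩
    ℚ.∣ a ℚ.* (b ℚ.- d) ∣ ℚ.+ ℚ.∣ (a ℚ.- c) ℚ.* d ∣
      ≡⟨ cong₂ ℚ._+_ (ℚ.∣p*q∣≡∣p∣*∣q∣ a (b ℚ.- d)) (ℚ.∣p*q∣≡∣p∣*∣q∣ (a ℚ.- c) d) ⟩
    ℚ.∣ a ∣ ℚ.* ℚ.∣ b ℚ.- d ∣ ℚ.+ ℚ.∣ a ℚ.- c ∣ ℚ.* ℚ.∣ d ∣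
      ≤⟨ ℚ.+-mono-≤ (*-mono-≤ (ℚ.0≤∣p∣ (b ℚ.- d)) A≥0 a≤A b-d≤β)
                    (*-mono-≤ (ℚ.0≤∣p∣ d) α≥0 a-c≤α d≤B) ⟩
    A ℚ.* β ℚ.+ α ℚ.* B ∎
    where
    open ℚ.+-*-Solver
    open ℚ.≤-Reasoning

  divide : ∀ {ε B} → 0ℚ ℚ.< ε → 0ℚ ℚ.< B → ∃[ α ] 0ℚ ℚ.< α × α ℚ.* B ≡ ε
  divide {ε} {B} ε>0 B>0 = ε ℚ.* ℚ.1/ B , α>0 ,
    trans (ℚ.*-assoc ε (ℚ.1/ B) B) (trans (cong (ε ℚ.*_) (ℚ.*-inverseˡ B)) (ℚ.*-identityʳ ε))
    where
    instance
      B⁺ : ℚ.Positive B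
      B⁺ = ℚ.positive B>0
      B≢0 : ℚ.NonZero B
      B≢0 = ℚ.pos⇒nonZero B
    α>0 : 0ℚ ℚ.< ε ℚ.* ℚ.1/ B
    α>0 = ℚ.positive⁻¹ (ε ℚ.* ℚ.1/ B)
      {{ℚ.pos*pos⇒pos ε {{ℚ.positive ε>0}} (ℚ.1/ B) {{ℚ.1/pos⇒pos B}}}}

  cauchy-* : ∀ f g → Cauchy f → Cauchy g → Cauchy (λ n → f n ℚ.* g n)
  cauchy-* f g cf cg ε ε>0 =
    combine (eventually-bounded f cf) (eventually-bounded g cg)
    where
    h : ℚ
    h = ½ ℚ.* ε
    Bound : (ℕ → ℚ) → Set
    Bound f = ∃[ B ] 0ℚ ℚ.< B × ∃[ N ] ∀ n → N ℕ.≤ n → ℚ.∣ f n ∣ ℚ.≤ B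
    Goal : Set
    Goal = ∃[ J ] ∀ m n → J ℕ.≤ m → J ℕ.≤ n → ℚ.∣ f m ℚ.* g m ℚ.- f n ℚ.* g n ∣ ℚ.≤ ε
    combine : Bound f → Bound g → Goal
    combine (A , A>0 , K , f≤A) (B , B>0 , L , g≤B) = J , λ m n J≤m J≤n →
      ℚ.≤-trans
        (product-close (f m) (g m) (f n) (g n) (ℚ.<⇒≤ A>0) (ℚ.<⇒≤ α>0)
          (f≤A m (K≤ J≤m)) (g≤B n (L≤ J≤n))
          (proj₂ Cf m n (M≤ J≤m) (M≤ J≤n)) (proj₂ Cg m n (N≤ J≤m) (N≤ J≤n)))
        (ℚ.≤-reflexive (trans
          (cong₂ ℚ._+_ (trans (ℚ.*-comm A β) (proj₂ (proj₂ D-β))) (proj₂ (proj₂ D-α)))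
          (½ε+½ε≡ε ε)))
      where
      D-α : ∃[ α ] 0ℚ ℚ.< α × α ℚ.* B ≡ h
      D-α = divide {h} {B} (½ε>0 {ε} ε>0) B>0
      D-β : ∃[ β ] 0ℚ ℚ.< β × β ℚ.* A ≡ h
      D-β = divide {h} {A} (½ε>0 {ε} ε>0) A>0
      α β : ℚ
      α = proj₁ D-α
      β = proj₁ D-β
      α>0 : 0ℚ ℚ.< α
      α>0 = proj₁ (proj₂ D-α)
      Cf : ∃[ M ] ∀ m n → M ℕ.≤ m → M ℕ.≤ n → ℚ.∣ f m ℚ.- f n ∣ ℚ.≤ α
      Cf = cf α α>0
      Cg : ∃[ N ] ∀ m n → N ℕ.≤ m → N ℕ.≤ n → ℚ.∣ g m ℚ.- g n ∣ ℚ.≤ β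
      Cg = cg β (proj₁ (proj₂ D-β))
      M N J : ℕ
      M = proj₁ Cf
      N = proj₁ Cg
      J = K ℕ.⊔ L ℕ.⊔ (M ℕ.⊔ N)
      K≤ : ∀ {m} → J ℕ.≤ m → K ℕ.≤ m
      K≤ le = ℕ.m⊔n≤o⇒m≤o K L (ℕ.m⊔n≤o⇒m≤o (K ℕ.⊔ L) (M ℕ.⊔ N) le)
      L≤ : ∀ {m} → J ℕ.≤ m → L ℕ.≤ m
      L≤ le = ℕ.m⊔n≤o⇒n≤o K L (ℕ.m⊔n≤o⇒m≤o (K ℕ.⊔ L) (M ℕ.⊔ N) le)
      M≤ : ∀ {m} → J ℕ.≤ m → M ℕ.≤ m
      M≤ le = ℕ.m⊔n≤o⇒m≤o M N (ℕ.m⊔n≤o⇒n≤o (K ℕ.⊔ L) (M ℕ.⊔ N) le)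
      N≤ : ∀ {m} → J ℕ.≤ m → N ℕ.≤ m
      N≤ le = ℕ.m⊔n≤o⇒n≤o M N (ℕ.m⊔n≤o⇒n≤o (K ℕ.⊔ L) (M ℕ.⊔ N) le)

  cauchy-√ : ∀ f → Cauchy f → Cauchy (λ n → sqrtApprox n (f n))
  cauchy-√ f cf ε ε>0 = M ℕ.⊔ N , λ m n le-m le-n → ∣p-q∣≤ε
    (sqrtApprox-close n m (f n) (f m) (unit≤h n (ℕ.m⊔n≤o⇒m≤o M N le-n))
      (close m n (ℕ.m⊔n≤o⇒n≤o M N le-m) (ℕ.m⊔n≤o⇒n≤o M N le-n)))
    (sqrtApprox-close m n (f m) (f n) (unit≤h m (ℕ.m⊔n≤o⇒m≤o M N le-m))
      (close n m (ℕ.m⊔n≤o⇒n≤o M N le-n) (ℕ.m⊔n≤o⇒n≤o M N le-m)))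
    where
    h : ℚ
    h = ½ ℚ.* ε
    arch : ∃[ M ] ∀ n → M ℕ.≤ n → unit n ℚ.≤ h
    arch = archimedean h (½ε>0 ε>0)
    modulus-h² : ∃[ N ] ∀ m n → N ℕ.≤ m → N ℕ.≤ n → ℚ.∣ f m ℚ.- f n ∣ ℚ.≤ h ℚ.* h
    modulus-h² = cf (h ℚ.* h) (ℚ.positive⁻¹ (h ℚ.* h)
      {{ℚ.pos*pos⇒pos h {{ℚ.positive (½ε>0 ε>0)}} h {{ℚ.positive (½ε>0 ε>0)}}}})
    M N : ℕ
    M = proj₁ arch
    N = proj₁ modulus-h²
    unit≤h : ∀ n → M ℕ.≤ n → unit n ℚ.≤ h
    unit≤h = proj₂ arch
    close : ∀ m n → N ℕ.≤ m → N ℕ.≤ n → ℚ.∣ f m ℚ.- f n ∣ ℚ.≤ h ℚ.* h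
    close = proj₂ modulus-h²

infixl 6 _+ᴿ_
infixl 7 _*ᴿ_
infix  8 -ᴿ_ √_

_+ᴿ_ _*ᴿ_ : ℝ → ℝ → ℝ
x +ᴿ y = mkℝ (λ n → seq x n ℚ.+ seq y n) (cauchy-+ (seq x) (seq y) (cauchy x) (cauchy y))
x *ᴿ y = mkℝ (λ n → seq x n ℚ.* seq y n) (cauchy-* (seq x) (seq y) (cauchy x) (cauchy y))

-ᴿ_ : ℝ → ℝ
-ᴿ x = mkℝ (λ n → ℚ.- seq x n) (cauchy-neg (seq x) (cauchy x))

-- Total: √ x is the nonnegative square root of |x|; only used at x ≥ 0.
√_ : ℝ → ℝ
√ x = mkℝ (λ n → sqrtApprox n (seq x n)) (cauchy-√ (seq x) (cauchy x))

record ℂ : Set where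
  constructor _+i_
  field
    re im : ℝ
open ℂ public

infix 4 _≈ᶜ_
infixl 6 _+ᶜ_
infixl 7 _*ᶜ_

_≈ᶜ_ : ℂ → ℂ → Set
z ≈ᶜ w = (re z ≈ᴿ re w) × (im z ≈ᴿ im w)

_+ᶜ_ _*ᶜ_ : ℂ → ℂ → ℂ
z +ᶜ w = (re z +ᴿ re w) +i (im z +ᴿ im w)
z *ᶜ w = (re z *ᴿ re w +ᴿ -ᴿ (im z *ᴿ im w)) +i (re z *ᴿ im w +ᴿ im z *ᴿ re w)

0ᶜ 1ᶜ : ℂ
0ᶜ = 0ᴿ +i 0ᴿ
1ᶜ = 1ᴿ +i 0ᴿ

∣_∣ᶜ : ℂ → ℝ
∣ z ∣ᶜ = √ (re z *ᴿ re z +ᴿ im z *ᴿ im z)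

ℂ-rawSemiring : RawSemiring 0ℓ 0ℓ
ℂ-rawSemiring = record
  { Carrier = ℂ ; _≈_ = _≈ᶜ_ ; _+_ = _+ᶜ_ ; _*_ = _*ᶜ_ ; 0# = 0ᶜ ; 1# = 1ᶜ }

open RawSemiringDefs ℂ-rawSemiring public using () renaming (sum to ∑ᶜ; _^_ to _^ᶜ_)

record 𝕋 : Set where
  field
    val     : ℂ
    modulus : ∣ val ∣ᶜ ≈ᴿ 1ᴿ
open 𝕋 public

Matrix : ℕ → Set
Matrix n = Fin n → Fin n → ℂ

IsEigenvalue : ∀ {n} → Matrix n → ℂ → Set
IsEigenvalue {n} A λ′ = Σ[ x ∈ Vector ℂ n ]
  (¬ (∀ i → x i ≈ᶜ 0ᶜ)) × (∀ i → ∑ᶜ (λ j → A i j *ᶜ x j) ≈ᶜ λ′ *ᶜ x i)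

-- "ρ(A) = r": r is the maximum of the moduli of the eigenvalues of A.
IsSpectralRadius : ∀ {n} → Matrix n → ℝ → Set
IsSpectralRadius A r =
  (∃[ λ′ ] IsEigenvalue A λ′ × ∣ λ′ ∣ᶜ ≈ᴿ r) ×
  (∀ λ′ → IsEigenvalue A λ′ → ∣ λ′ ∣ᶜ ≤ᴿ r)

record Digraph (n : ℕ) : Set where
  field
    arc      : Fin n → Fin n → Bool
    loopless : ∀ v → ¬ T (arc v v)

  Arc : Fin n → Fin n → Set
  Arc u v = T (arc u v)

  outNeighbours : Fin n → Subset n
  outNeighbours v = Vec.tabulate (arc v)

  deg⁺ : Fin n → ℕ
  deg⁺ v = ∣ outNeighbours v ∣

  -- The 0 is only the value of max on the empty list.
  Δ⁺ : ℕ
  Δ⁺ = max 0 (List.tabulate deg⁺)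

  OutRegular : Set
  OutRegular = ∀ v → deg⁺ v ≡ Δ⁺

  Walk : Fin n → Fin n → Set
  Walk = Star Arc

  -- The vertices of a walk in order, omitting the final one.
  sources : ∀ {u v} → Walk u v → List (Fin n)
  sources stop            = []
  sources (_◅_ {i} _ w) = i ∷ sources w

  length : ∀ {u v} → Walk u v → ℕ
  length w = List.length (sources w)

  record Path (u v : Fin n) : Set where
    field
      walk     : Walk u v
      distinct : Unique (sources walk ∷ʳ v)

  StronglyConnected : Set
  StronglyConnected = ∀ u v → Path u v

  record Cycle : Set where
    field
      base       : Fin n
      walk       : Walk base base
      nontrivial : 2 ℕ.≤ length walk
      distinct   : Unique (sources walk)

record GainDigraph (n : ℕ) : Set where
  field
    digraph : Digraph n
  open Digraph digraph public
  field
    φ : ∀ {u v} → Arc u v → 𝕋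

  adjacency : Matrix n
  adjacency i j with T? (arc i j)
  ... | yes a = val (φ a)
  ... | no  _ = 0ᶜ

  gain : ∀ {u v} → Walk u v → ℂ
  gain stop    = 1ᶜ
  gain (a ◅ w) = val (φ a) *ᶜ gain w

  Balanced : 𝕋 → Set
  Balanced μ = ∀ (C : Cycle) → gain (Cycle.walk C) ≈ᶜ val μ ^ᶜ length (Cycle.walk C)

{-# OPTIONS --safe #-}

-- Let λx = Ax, let i maximise |xᵢ|, and put Δ = Δ⁺, ν = λ/Δ, c = νxᵢ.  The
-- deg⁺(i) terms tⱼ = φ(i,j)xⱼ satisfy |tⱼ| ≤ |xᵢ| and sum to Δc, so expanding the squares
-- gives  ∑ⱼ |tⱼ - c|² + 2Δ|c|² ≤ deg⁺(i) (|xᵢ|² + |c|²).  In an out-regular digraph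
-- this forces |ν| ≤ 1.  If |ν| = 1 it forces deg⁺(i) = Δ and φ(i,j)xⱼ = νxᵢ for every
-- arc (i,j); then |xⱼ| is maximal too, strong connectivity spreads this to all vertices,
-- and multiplying along a cycle gives its gain as a power of ν.  Conversely, balance and
-- loop erasure make ∏ φ(a)μ̄ equal to 1 on every closed walk, so the product along a path
-- from v to a fixed root gives an eigenvector of eigenvalue Δμ.
--
-- A maximal |xᵢ| exists only up to double negation.  This is enough, because all
-- properties derived from it are ¬¬-stable, while μ is read off from λ directly.
module Submission where

open import Defs
open import Algebra.Bundles using (CommutativeMonoid)
import Algebra.Properties.CommutativeSemigroup as CommutativeSemigroupProperties
open import Data.Bool.Base using (Bool; true; false; T; if_then_else_)
open import Data.Bool.Properties using (T?; T-irrelevant) renaming (_≟_ to _≟ᵇ_)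
open import Data.Empty using (⊥-elim)
open import Data.Fin.Base using (Fin; zero; suc)
import Data.Fin.Properties as Fin
open import Data.Fin.Subset using (∣_∣)
open import Data.Integer.Base as ℤ using (+_)
import Data.Integer.Properties as ℤ
open import Data.List.Base as List using (List; _∷_; _∷ʳ_)
open import Data.List.Extrema.Nat using (xs≤max)
open import Data.List.Membership.DecPropositional using (_∈?_)
open import Data.List.Membership.Propositional using (_∈_; _∉_)
open import Data.List.Membership.Propositional.Properties using (∈-++⁺ʳ)
open import Data.List.Relation.Binary.Subset.Propositional using (_⊆_)
open import Data.List.Relation.Unary.All using (All)
open import Data.List.Relation.Unary.All.Properties using (tabulate⁻; ¬Any⇒All¬; All¬⇒¬Any)
open import Data.List.Relation.Unary.AllPairs using ([]; _∷_)
open import Data.List.Relation.Unary.Any using (here; there)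
open import Data.List.Relation.Unary.Unique.Propositional using (Unique)
open import Data.Nat.Base as ℕ using (ℕ; zero; suc; NonZero; z≤n; s≤s)
import Data.Nat.Properties as ℕ
open import Data.Product using (_×_; Σ-syntax; ∃-syntax; _,_; proj₁; proj₂)
open import Data.Rational.Base as ℚ using (ℚ; 0ℚ; 1ℚ; ½; toℚᵘ)
import Data.Rational.Properties as ℚ
open import Data.Rational.Solver using (module +-*-Solver)
import Data.Rational.Unnormalised.Base as ℚᵘ
import Data.Rational.Unnormalised.Properties as ℚᵘ
open import Data.Sum.Base using (_⊎_; inj₁; inj₂)
open import Data.Unit.Base using (tt)
import Data.Vec.Base as Vec
open import Data.Vec.Functional using (Vector)
open import Function.Base using (_∘_; id)
open import Function.Bundles using (_⇔_; mk⇔)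
open import Level using (0ℓ)
open import Relation.Binary.Construct.Closure.ReflexiveTransitive
  using (_◅_; _◅◅_) renaming (ε to stop)
open import Relation.Binary.PropositionalEquality
  using (_≡_; refl; sym; trans; cong; cong₂; subst; subst₂)
import Relation.Binary.Reasoning.Setoid as SetoidReasoning
open import Relation.Nullary using (¬_; Dec; yes; no; does)
open import Relation.Nullary.Decidable using (decidable-stable)
open +-*-Solver using (solve; con; _:=_; _:+_; _:*_; _:-_; :-_)

private variable
  n : ℕ
  x y z x′ y′ : ℝ

-- Inequalities between rationals

-- Reduces an order step to a ring identity: once b - a and d - c agree, which the solver can check,
-- one inequality gives the other.
≤-shift : ∀ {a b c d} → a ℚ.≤ b → b ℚ.- a ≡ d ℚ.- c → c ℚ.≤ d
≤-shift {a} {b} {c} {d} a≤b b-a≡d-c = subst₂ ℚ._≤_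
  (solve 2 (λ a c → a :+ (c :- a) := c) refl a c)
  (trans (solve 3 (λ a b c → b :+ (c :- a) := (b :- a) :+ c) refl a b c)
    (trans (cong (ℚ._+ c) b-a≡d-c) (solve 2 (λ c d → (d :- c) :+ c := d) refl c d)))
  (ℚ.+-monoˡ-≤ (c ℚ.- a) a≤b)

∣p-q∣≤ε⇒p≤q+ε : ∀ {p q ε} → ℚ.∣ p ℚ.- q ∣ ℚ.≤ ε → p ℚ.≤ q ℚ.+ ε
∣p-q∣≤ε⇒p≤q+ε {p} {q} {ε} h = ≤-shift (ℚ.≤-trans p-q≤∣p-q∣ h)
  (solve 3 (λ p q ε → ε :- (p :- q) := (q :+ ε) :- p) refl p q ε)
  where
  p-q≤∣p-q∣ : p ℚ.- q ℚ.≤ ℚ.∣ p ℚ.- q ∣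
  p-q≤∣p-q∣ with ℚ.≤-total 0ℚ (p ℚ.- q)
  ... | inj₁ 0≤d = ℚ.≤-reflexive (sym (ℚ.0≤p⇒∣p∣≡p 0≤d))
  ... | inj₂ d≤0 = ℚ.≤-trans d≤0 (ℚ.0≤∣p∣ (p ℚ.- q))

∣p-q∣≤ε⇒q≤p+ε : ∀ {p q ε} → ℚ.∣ p ℚ.- q ∣ ℚ.≤ ε → q ℚ.≤ p ℚ.+ ε
∣p-q∣≤ε⇒q≤p+ε {p} {q} {ε} h = ∣p-q∣≤ε⇒p≤q+ε (subst (ℚ._≤ ε)
  (trans (sym (ℚ.∣-p∣≡∣p∣ (p ℚ.- q)))
    (cong ℚ.∣_∣ (solve 2 (λ p q → :- (p :- q) := q :- p) refl p q))) h)

0<p*q : ∀ {p q} → 0ℚ ℚ.< p → 0ℚ ℚ.< q → 0ℚ ℚ.< p ℚ.* q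
0<p*q {p} {q} 0<p 0<q = ℚ.positive⁻¹ (p ℚ.* q)
  {{ℚ.pos*pos⇒pos p {{ℚ.positive 0<p}} q {{ℚ.positive 0<q}}}}

0≤p*p : ∀ p → 0ℚ ℚ.≤ p ℚ.* p
0≤p*p p with ℚ.≤-total 0ℚ p
... | inj₁ 0≤p = subst (ℚ._≤ p ℚ.* p) (ℚ.*-zeroˡ 0ℚ) (*-mono-≤ ℚ.≤-refl 0≤p 0≤p 0≤p)
... | inj₂ p≤0 = subst₂ ℚ._≤_ (ℚ.*-zeroˡ 0ℚ) (solve 1 (λ p → :- p :* :- p := p :* p) refl p)
  (*-mono-≤ ℚ.≤-refl 0≤-p 0≤-p 0≤-p)
  where
  0≤-p : 0ℚ ℚ.≤ ℚ.- p
  0≤-p = ≤-shift p≤0 (solve 1 (λ p → con 0ℚ :- p := :- p :- con 0ℚ) refl p)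

-- Properties that hold from some index on

Eventually : (ℕ → Set) → Set
Eventually P = ∃[ N ] ∀ n → N ℕ.≤ n → P n

Eventually-zip : ∀ {P Q R : ℕ → Set} → (∀ n → P n → Q n → R n) →
  Eventually P → Eventually Q → Eventually R
Eventually-zip f (M , p) (N , q) = M ℕ.⊔ N , λ n le →
  f n (p n (ℕ.m⊔n≤o⇒m≤o M N le)) (q n (ℕ.m⊔n≤o⇒n≤o M N le))

Eventually-map : ∀ {P Q : ℕ → Set} → (∀ n → P n → Q n) → Eventually P → Eventually Q
Eventually-map f (N , p) = N , λ n le → f n (p n le)

Eventually-witness : ∀ {P : ℕ → Set} → Eventually P → ∃[ n ] P n
Eventually-witness (N , p) = N , p N ℕ.≤-refl

-- Order and equality of reals

infix 4 _<ᴿ_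

-- The strict order with a witness: one rational gap that persists from some index on. It carries
-- more information than the negation of the reverse `_≤ᴿ_`.
_<ᴿ_ : ℝ → ℝ → Set
x <ᴿ y = ∃[ δ ] 0ℚ ℚ.< δ × Eventually (λ n → seq x n ℚ.+ δ ℚ.≤ seq y n)

≤ᴿ-pointwise : (∀ n → seq x n ℚ.≤ seq y n) → x ≤ᴿ y
≤ᴿ-pointwise {x} {y} h ε ε>0 = 0 , λ n _ → ℚ.≤-trans (h n)
  (subst (ℚ._≤ seq y n ℚ.+ ε) (ℚ.+-identityʳ (seq y n)) (ℚ.+-monoʳ-≤ (seq y n) (ℚ.<⇒≤ ε>0)))

≤ᴿ-refl : x ≤ᴿ x
≤ᴿ-refl {x} = ≤ᴿ-pointwise {x} {x} (λ _ → ℚ.≤-refl)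

≤ᴿ-trans : x ≤ᴿ y → y ≤ᴿ z → x ≤ᴿ z
≤ᴿ-trans {x} {y} {z} x≤y y≤z ε ε>0 = Eventually-zip
  (λ n p q → ℚ.≤-trans p (≤-shift q (trans
    (solve 3 (λ y z h → z :+ h :- y := z :+ (h :+ h) :- (y :+ h))
      refl (seq y n) (seq z n) (½ ℚ.* ε))
    (cong (λ e → seq z n ℚ.+ e ℚ.- (seq y n ℚ.+ ½ ℚ.* ε)) (½ε+½ε≡ε ε)))))
  (x≤y (½ ℚ.* ε) (½ε>0 ε>0)) (y≤z (½ ℚ.* ε) (½ε>0 ε>0))

≤ᴿ-antisym : x ≤ᴿ y → y ≤ᴿ x → x ≈ᴿ y
≤ᴿ-antisym x≤y y≤x ε ε>0 =
  Eventually-zip (λ _ p q → ∣p-q∣≤ε p q) (x≤y ε ε>0) (y≤x ε ε>0)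

≈⇒≤ : x ≈ᴿ y → x ≤ᴿ y
≈⇒≤ {x} {y} x≈y ε ε>0 = Eventually-map (λ n → ∣p-q∣≤ε⇒p≤q+ε {seq x n} {seq y n}) (x≈y ε ε>0)

≈⇒≥ : x ≈ᴿ y → y ≤ᴿ x
≈⇒≥ {x} {y} x≈y ε ε>0 = Eventually-map (λ n → ∣p-q∣≤ε⇒q≤p+ε {seq x n} {seq y n}) (x≈y ε ε>0)

≈ᴿ-pointwise : (∀ n → seq x n ≡ seq y n) → x ≈ᴿ y
≈ᴿ-pointwise {x} {y} h = ≤ᴿ-antisym {x} {y}
  (≤ᴿ-pointwise {x} {y} (λ n → ℚ.≤-reflexive (h n)))
  (≤ᴿ-pointwise {y} {x} (λ n → ℚ.≤-reflexive (sym (h n))))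

≈ᴿ-refl : x ≈ᴿ x
≈ᴿ-refl {x} = ≈ᴿ-pointwise {x} {x} (λ _ → refl)

≈ᴿ-sym : x ≈ᴿ y → y ≈ᴿ x
≈ᴿ-sym {x} {y} e = ≤ᴿ-antisym {y} {x} (≈⇒≥ {x} {y} e) (≈⇒≤ {x} {y} e)

≈ᴿ-trans : x ≈ᴿ y → y ≈ᴿ z → x ≈ᴿ z
≈ᴿ-trans {x} {y} {z} e f = ≤ᴿ-antisym {x} {z}
  (≤ᴿ-trans {x} {y} {z} (≈⇒≤ {x} {y} e) (≈⇒≤ {y} {z} f))
  (≤ᴿ-trans {z} {y} {x} (≈⇒≥ {y} {z} f) (≈⇒≥ {x} {y} e))

≤ᴿ-shift : ∀ x y z w → x ≤ᴿ y →
  (∀ n → seq y n ℚ.- seq x n ≡ seq w n ℚ.- seq z n) → z ≤ᴿ w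
≤ᴿ-shift x y z w x≤y e ε ε>0 = Eventually-map
  (λ n p → ≤-shift p (trans
    (solve 3 (λ x y ε → (y :+ ε) :- x := (y :- x) :+ ε) refl (seq x n) (seq y n) ε)
    (trans (cong (ℚ._+ ε) (e n))
      (solve 3 (λ z w ε → (w :- z) :+ ε := (w :+ ε) :- z) refl (seq z n) (seq w n) ε))))
  (x≤y ε ε>0)

+ᴿ-mono-≤ : x ≤ᴿ x′ → y ≤ᴿ y′ → (x +ᴿ y) ≤ᴿ (x′ +ᴿ y′)
+ᴿ-mono-≤ {x} {x′} {y} {y′} p q = ≤ᴿ-trans {x +ᴿ y} {x′ +ᴿ y} {x′ +ᴿ y′}
  (≤ᴿ-shift x x′ (x +ᴿ y) (x′ +ᴿ y) p λ n →
    solve 3 (λ a b c → b :- a := (b :+ c) :- (a :+ c)) refl (seq x n) (seq x′ n) (seq y n))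
  (≤ᴿ-shift y y′ (x′ +ᴿ y) (x′ +ᴿ y′) q λ n →
    solve 3 (λ a b c → b :- a := (c :+ b) :- (c :+ a)) refl (seq y n) (seq y′ n) (seq x′ n))

neg-anti-≤ : x ≤ᴿ y → (-ᴿ y) ≤ᴿ (-ᴿ x)
neg-anti-≤ {x} {y} p = ≤ᴿ-shift x y (-ᴿ y) (-ᴿ x) p λ n →
  solve 2 (λ a b → b :- a := :- a :- :- b) refl (seq x n) (seq y n)

+ᴿ-cong : x ≈ᴿ x′ → y ≈ᴿ y′ → (x +ᴿ y) ≈ᴿ (x′ +ᴿ y′)
+ᴿ-cong {x} {x′} {y} {y′} e f = ≤ᴿ-antisym {x +ᴿ y} {x′ +ᴿ y′}
  (+ᴿ-mono-≤ {x} {x′} {y} {y′} (≈⇒≤ {x} {x′} e) (≈⇒≤ {y} {y′} f))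
  (+ᴿ-mono-≤ {x′} {x} {y′} {y} (≈⇒≥ {x} {x′} e) (≈⇒≥ {y} {y′} f))

-ᴿ-cong : x ≈ᴿ y → (-ᴿ x) ≈ᴿ (-ᴿ y)
-ᴿ-cong {x} {y} e = ≤ᴿ-antisym { -ᴿ x} { -ᴿ y}
  (neg-anti-≤ {y} {x} (≈⇒≥ {x} {y} e)) (neg-anti-≤ {x} {y} (≈⇒≤ {x} {y} e))

*ᴿ-cong : x ≈ᴿ x′ → y ≈ᴿ y′ → (x *ᴿ y) ≈ᴿ (x′ *ᴿ y′)
*ᴿ-cong {x} {x′} {y} {y′} e f ε ε>0
  with eventually-bounded (seq x) (cauchy x) | eventually-bounded (seq y′) (cauchy y′)
-- With α = ε/(2B) and β = ε/(2A), the error bound A β + α B of `product-close` comes to ε.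
... | A , A>0 , boundA | B , B>0 , boundB with divide {½ ℚ.* ε} {B} (½ε>0 ε>0) B>0
                                             | divide {½ ℚ.* ε} {A} (½ε>0 ε>0) A>0
... | α , α>0 , αB≡ | β , β>0 , βA≡ =
  Eventually-zip
    (λ n (a≤A , b≤B) (p , q) → ℚ.≤-trans
      (product-close (seq x n) (seq y n) (seq x′ n) (seq y′ n)
        (ℚ.<⇒≤ A>0) (ℚ.<⇒≤ α>0) a≤A b≤B p q)
      (ℚ.≤-reflexive (trans (cong₂ ℚ._+_ (trans (ℚ.*-comm A β) βA≡) αB≡) (½ε+½ε≡ε ε))))
    (Eventually-zip (λ _ → _,_) boundA boundB)
    (Eventually-zip (λ _ → _,_) (e α α>0) (f β β>0))

-- At a common index the gap δ meets the slack δ/2, which would give δ/2 ≤ 0.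
<⇒≱ : x <ᴿ y → ¬ (y ≤ᴿ x)
<⇒≱ {x} {y} (δ , δ>0 , x+δ≤y) y≤x
  with Eventually-witness (Eventually-zip (λ _ → _,_) x+δ≤y (y≤x (½ ℚ.* δ) (½ε>0 δ>0)))
... | n , p , q = ℚ.<-irrefl refl (ℚ.<-≤-trans (½ε>0 δ>0)
  (≤-shift (ℚ.≤-trans p q) (trans
    (cong (λ e → seq x n ℚ.+ ½ ℚ.* δ ℚ.- (seq x n ℚ.+ e)) (sym (½ε+½ε≡ε δ)))
    (solve 2 (λ x h → x :+ h :- (x :+ (h :+ h)) := con 0ℚ :- h) refl (seq x n) (½ ℚ.* δ)))))

<⇒≤ : x <ᴿ y → x ≤ᴿ y
<⇒≤ {x} {y} (δ , δ>0 , x+δ≤y) ε ε>0 = Eventually-map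
  (λ n p → ℚ.≤-trans (subst (ℚ._≤ seq x n ℚ.+ δ) (ℚ.+-identityʳ _)
                        (ℚ.+-monoʳ-≤ (seq x n) (ℚ.<⇒≤ δ>0)))
    (ℚ.≤-trans p (subst (ℚ._≤ seq y n ℚ.+ ε) (ℚ.+-identityʳ _)
                        (ℚ.+-monoʳ-≤ (seq y n) (ℚ.<⇒≤ ε>0)))))
  x+δ≤y

-- Comparing far-out approximations decides x ≤ y up to ε.
<ᴿ∨≤+ε : ∀ x y {ε} → 0ℚ ℚ.< ε →
  (y <ᴿ x) ⊎ Eventually (λ n → seq x n ℚ.≤ seq y n ℚ.+ ε)
<ᴿ∨≤+ε x y {ε} ε>0 = compare (seq x K ℚ.≤? seq y K ℚ.+ (e ℚ.+ e ℚ.+ e))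
  where
  -- Here e = ε/5. The test at index K allows 3e. If it succeeds, passing from K to n costs e for
  -- each sequence, 5e in all; if it fails, these costs still leave a gap e.
  fifth e : ℚ
  fifth = unit 4
  e = fifth ℚ.* ε
  e>0 : 0ℚ ℚ.< e
  e>0 = 0<p*q (unit>0 4) ε>0
  M N K : ℕ
  M = proj₁ (cauchy x e e>0)
  N = proj₁ (cauchy y e e>0)
  K = M ℕ.⊔ N
  closeˣ : ∀ n → K ℕ.≤ n → ℚ.∣ seq x n ℚ.- seq x K ∣ ℚ.≤ e
  closeˣ n K≤n = proj₂ (cauchy x e e>0) n K (ℕ.m⊔n≤o⇒m≤o M N K≤n) (ℕ.m≤m⊔n M N)
  belowˣ : ∀ n → K ℕ.≤ n → seq x n ℚ.≤ seq x K ℚ.+ e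
  belowˣ n K≤n = ∣p-q∣≤ε⇒p≤q+ε {seq x n} {seq x K} (closeˣ n K≤n)
  aboveˣ : ∀ n → K ℕ.≤ n → seq x K ℚ.≤ seq x n ℚ.+ e
  aboveˣ n K≤n = ∣p-q∣≤ε⇒q≤p+ε {seq x n} {seq x K} (closeˣ n K≤n)
  closeʸ : ∀ n → K ℕ.≤ n → ℚ.∣ seq y n ℚ.- seq y K ∣ ℚ.≤ e
  closeʸ n K≤n = proj₂ (cauchy y e e>0) n K (ℕ.m⊔n≤o⇒n≤o M N K≤n) (ℕ.m≤n⊔m M N)
  belowʸ : ∀ n → K ℕ.≤ n → seq y n ℚ.≤ seq y K ℚ.+ e
  belowʸ n K≤n = ∣p-q∣≤ε⇒p≤q+ε {seq y n} {seq y K} (closeʸ n K≤n)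
  aboveʸ : ∀ n → K ℕ.≤ n → seq y K ℚ.≤ seq y n ℚ.+ e
  aboveʸ n K≤n = ∣p-q∣≤ε⇒q≤p+ε {seq y n} {seq y K} (closeʸ n K≤n)
  compare : Dec (seq x K ℚ.≤ seq y K ℚ.+ (e ℚ.+ e ℚ.+ e)) →
    (y <ᴿ x) ⊎ Eventually (λ n → seq x n ℚ.≤ seq y n ℚ.+ ε)
  compare (yes p) = inj₂ (K , λ n K≤n → ≤-shift
    (ℚ.+-mono-≤ p (ℚ.+-mono-≤ (belowˣ n K≤n) (aboveʸ n K≤n)))
    (solve 5 (λ x y xₙ yₙ ε → let e = con fifth :* ε in
        ((y :+ (e :+ e :+ e)) :+ ((x :+ e) :+ (yₙ :+ e))) :- (x :+ (xₙ :+ y))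
        := (yₙ :+ ε) :- xₙ)
      refl (seq x K) (seq y K) (seq x n) (seq y n) ε))
  compare (no ¬p) = inj₁ (e , e>0 , K , λ n K≤n → ≤-shift
    (ℚ.+-mono-≤ (ℚ.<⇒≤ (ℚ.≰⇒> ¬p))
      (ℚ.+-mono-≤ (aboveˣ n K≤n) (belowʸ n K≤n)))
    (solve 5 (λ x y xₙ yₙ e →
        (x :+ ((xₙ :+ e) :+ (y :+ e))) :- ((y :+ (e :+ e :+ e)) :+ (x :+ yₙ))
        := xₙ :- (yₙ :+ e))
      refl (seq x K) (seq y K) (seq x n) (seq y n) e))

-- Stability under double negation; products and the order

-- For each ε, either the required approximate inequality holds or y <ᴿ x, and the latter refutes x
-- ≤ᴿ y. Hence arguments by contradiction are available for `_≤ᴿ_` although it is undecidable.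
≤ᴿ-stable : ¬ ¬ (x ≤ᴿ y) → x ≤ᴿ y
≤ᴿ-stable {x} {y} ¬¬x≤y ε ε>0 with <ᴿ∨≤+ε x y ε>0
... | inj₁ y<x = ⊥-elim (¬¬x≤y (<⇒≱ {y} {x} y<x))
... | inj₂ x≤y+ε = x≤y+ε

≰⇒≥ : ¬ (x ≤ᴿ y) → y ≤ᴿ x
≰⇒≥ {x} {y} x≰y ε ε>0 with <ᴿ∨≤+ε y x ε>0
... | inj₁ x<y = ⊥-elim (x≰y (<⇒≤ {x} {y} x<y))
... | inj₂ y≤x+ε = y≤x+ε

≮⇒≥ : ¬ (x <ᴿ y) → y ≤ᴿ x
≮⇒≥ {x} {y} x≮y ε ε>0 with <ᴿ∨≤+ε y x ε>0
... | inj₁ x<y = ⊥-elim (x≮y x<y)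
... | inj₂ y≤x+ε = y≤x+ε

≈ᴿ-stable : ¬ ¬ (x ≈ᴿ y) → x ≈ᴿ y
≈ᴿ-stable {x} {y} h = ≤ᴿ-antisym {x} {y}
  (≤ᴿ-stable {x} {y} (λ k → h (λ e → k (≈⇒≤ {x} {y} e))))
  (≤ᴿ-stable {y} {x} (λ k → h (λ e → k (≈⇒≥ {x} {y} e))))

*ᴿ-monoʳ-< : ∀ x y z → 0ᴿ <ᴿ x → y <ᴿ z → (x *ᴿ y) <ᴿ (x *ᴿ z)
*ᴿ-monoʳ-< x y z (δ , δ>0 , δ≤x) (η , η>0 , y+η≤z) = δ ℚ.* η , 0<p*q δ>0 η>0 ,
  Eventually-zip
    (λ n p q → ≤-shift
      (*-mono-≤ (ℚ.<⇒≤ η>0) (ℚ.≤-trans (ℚ.<⇒≤ δ>0) (subst (ℚ._≤ seq x n) (ℚ.+-identityˡ δ) p))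
        (subst (ℚ._≤ seq x n) (ℚ.+-identityˡ δ) p)
        (≤-shift q (solve 3 (λ y z η → z :- (y :+ η) := (z :- y) :- η) refl (seq y n) (seq z n) η)))
      (solve 5 (λ x y z δ η → x :* (z :- y) :- δ :* η := x :* z :- (x :* y :+ δ :* η))
        refl (seq x n) (seq y n) (seq z n) δ η))
    δ≤x y+η≤z

-- The hypothesis on x yields 0 <ᴿ x only up to double negation. This is enough, since the
-- conclusion is reached by refuting z <ᴿ y.
*ᴿ-cancelˡ-≤ : ∀ x y z → ¬ (x ≤ᴿ 0ᴿ) → (x *ᴿ y) ≤ᴿ (x *ᴿ z) → y ≤ᴿ z
*ᴿ-cancelˡ-≤ x y z x≰0 xy≤xz = ≮⇒≥ {z} {y} λ z<y → x≰0 (≮⇒≥ {0ᴿ} {x} λ 0<x →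
  <⇒≱ {x *ᴿ z} {x *ᴿ y} (*ᴿ-monoʳ-< x z y 0<x z<y) xy≤xz)

-- By contradiction, which avoids deciding the sign of x. If 0 < x, then y < z would give the claim,
-- so y ≈ z and the products agree. Hence x ≈ 0, and both products vanish.
*ᴿ-monoʳ-≤ : ∀ x y z → 0ᴿ ≤ᴿ x → y ≤ᴿ z → (x *ᴿ y) ≤ᴿ (x *ᴿ z)
*ᴿ-monoʳ-≤ x y z 0≤x y≤z = ≤ᴿ-stable {x *ᴿ y} {x *ᴿ z} λ xy≰xz →
  let 0<x→z≤y : 0ᴿ <ᴿ x → z ≤ᴿ y
      0<x→z≤y 0<x = ≮⇒≥ {y} {z} λ y<z → xy≰xz (<⇒≤ {x *ᴿ y} {x *ᴿ z} (*ᴿ-monoʳ-< x y z 0<x y<z))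
      x≤0 : x ≤ᴿ 0ᴿ
      x≤0 = ≮⇒≥ {0ᴿ} {x} λ 0<x → xy≰xz (≈⇒≤ {x *ᴿ y} {x *ᴿ z}
        (*ᴿ-cong {x} {x} {y} {z} (≈ᴿ-refl {x}) (≤ᴿ-antisym {y} {z} y≤z (0<x→z≤y 0<x))))
      x≈0 : x ≈ᴿ 0ᴿ
      x≈0 = ≤ᴿ-antisym {x} {0ᴿ} x≤0 0≤x
      xw≈0 : ∀ w → (x *ᴿ w) ≈ᴿ 0ᴿ
      xw≈0 w = ≈ᴿ-trans {x *ᴿ w} {0ᴿ *ᴿ w} {0ᴿ} (*ᴿ-cong {x} {0ᴿ} {w} {w} x≈0 (≈ᴿ-refl {w}))
        (≈ᴿ-pointwise {0ᴿ *ᴿ w} {0ᴿ} (λ n → ℚ.*-zeroˡ (seq w n)))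
  in xy≰xz (≈⇒≤ {x *ᴿ y} {x *ᴿ z}
       (≈ᴿ-trans {x *ᴿ y} {0ᴿ} {x *ᴿ z} (xw≈0 y) (≈ᴿ-sym {x *ᴿ z} {0ᴿ} (xw≈0 z))))

*ᴿ-mono-≤ : ∀ x x′ y y′ → 0ᴿ ≤ᴿ y → 0ᴿ ≤ᴿ x′ → x ≤ᴿ x′ → y ≤ᴿ y′ → (x *ᴿ y) ≤ᴿ (x′ *ᴿ y′)
*ᴿ-mono-≤ x x′ y y′ 0≤y 0≤x′ x≤x′ y≤y′ = ≤ᴿ-trans {x *ᴿ y} {x′ *ᴿ y} {x′ *ᴿ y′}
  (≤ᴿ-shift (y *ᴿ x) (y *ᴿ x′) (x *ᴿ y) (x′ *ᴿ y) (*ᴿ-monoʳ-≤ y x x′ 0≤y x≤x′)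
    λ n → solve 3 (λ x x′ y → y :* x′ :- y :* x := x′ :* y :- x :* y)
      refl (seq x n) (seq x′ n) (seq y n))
  (*ᴿ-monoʳ-≤ x′ y y′ 0≤x′ y≤y′)

-- If x ≤ y failed, then y ≤ x and x is not ≤ 0, so x can be cancelled from x² ≤ y² ≤ x y.
square-cancelᴿ-≤ : ∀ x y → 0ᴿ ≤ᴿ y → (x *ᴿ x) ≤ᴿ (y *ᴿ y) → x ≤ᴿ y
square-cancelᴿ-≤ x y 0≤y x²≤y² = ≤ᴿ-stable {x} {y} λ x≰y →
  let y≤x = ≰⇒≥ {x} {y} x≰y in
  x≰y (*ᴿ-cancelˡ-≤ x x y (λ x≤0 → x≰y (≤ᴿ-trans {x} {0ᴿ} {y} x≤0 0≤y))
    (≤ᴿ-trans {x *ᴿ x} {y *ᴿ y} {x *ᴿ y} x²≤y² (*ᴿ-mono-≤ y x y y 0≤y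
      (≤ᴿ-trans {0ᴿ} {y} {x} 0≤y y≤x) y≤x (≤ᴿ-refl {y}))))

-- Square cancellation against 0, once for x and once for -x.
square-cancel-≈0 : ∀ x → (x *ᴿ x) ≤ᴿ 0ᴿ → x ≈ᴿ 0ᴿ
square-cancel-≈0 x x²≤0 = ≤ᴿ-antisym {x} {0ᴿ}
  (square-cancelᴿ-≤ x 0ᴿ (≤ᴿ-refl {0ᴿ})
    (≤ᴿ-shift (x *ᴿ x) 0ᴿ (x *ᴿ x) (0ᴿ *ᴿ 0ᴿ) x²≤0 (λ n → refl)))
  (≤ᴿ-shift (-ᴿ x) 0ᴿ 0ᴿ x
    (square-cancelᴿ-≤ (-ᴿ x) 0ᴿ (≤ᴿ-refl {0ᴿ})
      (≤ᴿ-shift (x *ᴿ x) 0ᴿ (-ᴿ x *ᴿ -ᴿ x) (0ᴿ *ᴿ 0ᴿ) x²≤0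
        (λ n → solve 1 (λ x → con 0ℚ :- x :* x := con 0ℚ :* con 0ℚ :- (:- x :* :- x))
          refl (seq x n))))
    (λ n → solve 1 (λ x → con 0ℚ :- :- x := x :- con 0ℚ) refl (seq x n)))

-- Square roots

-- The error bound 1/(1 + n) of `sqrtApprox` at index n, packaged as a real that equals 0.
unitᴿ : ℝ
unitᴿ = mkℝ unit λ ε ε>0 → let N , unit≤ε = archimedean ε ε>0 in
  N , λ m n N≤m N≤n → ∣p-q∣≤ε
    (ℚ.≤-trans (unit≤ε m N≤m) (ℚ.≤-trans (ℚ.≤-reflexive (sym (ℚ.+-identityˡ ε)))
      (ℚ.+-monoˡ-≤ ε (ℚ.<⇒≤ (unit>0 n)))))
    (ℚ.≤-trans (unit≤ε n N≤n) (ℚ.≤-trans (ℚ.≤-reflexive (sym (ℚ.+-identityˡ ε)))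
      (ℚ.+-monoˡ-≤ ε (ℚ.<⇒≤ (unit>0 m)))))

unitᴿ≈0 : unitᴿ ≈ᴿ 0ᴿ
unitᴿ≈0 = ≤ᴿ-antisym {unitᴿ} {0ᴿ}
  (λ ε ε>0 → Eventually-map (λ n p → subst (unit n ℚ.≤_) (sym (ℚ.+-identityˡ ε)) p)
    (archimedean ε ε>0))
  (≤ᴿ-pointwise {0ᴿ} {unitᴿ} (λ n → ℚ.<⇒≤ (unit>0 n)))

√-nonNeg : ∀ x → 0ᴿ ≤ᴿ √ x
√-nonNeg x = ≤ᴿ-pointwise {0ᴿ} {√ x} (λ n → SqrtApprox.sqrtApprox≥0 n (seq x n))

-- At every index s² ≤ |xₙ| ≤ (s + u)² with u the error `unit n`, and u vanishes as a real. The
-- hypothesis on each xₙ turns |xₙ| into xₙ.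
√-square : ∀ x → (∀ n → 0ℚ ℚ.≤ seq x n) → (√ x *ᴿ √ x) ≈ᴿ x
√-square x 0≤x = ≤ᴿ-antisym {√ x *ᴿ √ x} {x}
  (≤ᴿ-pointwise {√ x *ᴿ √ x} {x} λ n →
    subst (seq (√ x *ᴿ √ x) n ℚ.≤_) (ℚ.0≤p⇒∣p∣≡p (0≤x n)) (SqrtApprox.sqrtApprox-lower n (seq x n)))
  (≤ᴿ-trans {x} {s+u *ᴿ s+u} {√ x *ᴿ √ x}
    (≤ᴿ-pointwise {x} {s+u *ᴿ s+u} λ n →
      subst (ℚ._≤ seq (s+u *ᴿ s+u) n) (ℚ.0≤p⇒∣p∣≡p (0≤x n)) (SqrtApprox.sqrtApprox-upper n (seq x n)))
    (≈⇒≤ {s+u *ᴿ s+u} {√ x *ᴿ √ x} (*ᴿ-cong {s+u} {√ x} {s+u} {√ x} s+u≈s s+u≈s)))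
  where
  s+u : ℝ
  s+u = √ x +ᴿ unitᴿ
  s+u≈s : s+u ≈ᴿ √ x
  s+u≈s = ≈ᴿ-trans {s+u} {√ x +ᴿ 0ᴿ} {√ x}
    (+ᴿ-cong {√ x} {√ x} {unitᴿ} {0ᴿ} (≈ᴿ-refl {√ x}) unitᴿ≈0)
    (≈ᴿ-pointwise {√ x +ᴿ 0ᴿ} {√ x} (λ n → ℚ.+-identityʳ _))

-- Natural numbers as reals

-- Checked on unnormalised rationals, where no reduction to lowest terms blocks the computation.
fromℕ-suc : ∀ n → (+ suc n) ℚ./ 1 ≡ 1ℚ ℚ.+ (+ n) ℚ./ 1
fromℕ-suc n = ℚ.toℚᵘ-injective (ℚᵘ.≃-trans (ℚ.toℚᵘ-fromℚᵘ (ℚᵘ.mkℚᵘ (+ suc n) 0))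
  (ℚᵘ.≃-trans (ℚᵘ.*≡* (cong (λ k → (+ 1 ℤ.+ k) ℤ.* + 1) (sym (ℤ.*-identityʳ (+ n)))))
  (ℚᵘ.≃-sym (ℚᵘ.≃-trans (ℚ.toℚᵘ-homo-+ 1ℚ ((+ n) ℚ./ 1))
    (ℚᵘ.+-cong (ℚᵘ.≃-refl {toℚᵘ 1ℚ}) (ℚ.toℚᵘ-fromℚᵘ (ℚᵘ.mkℚᵘ (+ n) 0)))))))

-- The order on ℚ is decidable, and p > q would supply the gap p - q for a strict inequality of
-- reals.
fromℚ-cancel-≤ : ∀ p q → fromℚ p ≤ᴿ fromℚ q → p ℚ.≤ q
fromℚ-cancel-≤ p q p≤q with p ℚ.≤? q
... | yes le = le
... | no p≰q = ⊥-elim (<⇒≱ {fromℚ q} {fromℚ p} (p ℚ.- q ,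
  subst (ℚ._< p ℚ.- q) (ℚ.+-inverseʳ q) (ℚ.+-monoˡ-< (ℚ.- q) (ℚ.≰⇒> p≰q)) ,
  0 , λ _ _ → ℚ.≤-reflexive (solve 2 (λ p q → q :+ (p :- q) := p) refl p q)) p≤q)

fromℕ-cancel-≤ : ∀ m n → fromℕ m ≤ᴿ fromℕ n → m ℕ.≤ n
fromℕ-cancel-≤ m n m≤n = ℤ.drop‿+≤+ (subst₂ ℤ._≤_ (ℤ.*-identityʳ (+ m)) (ℤ.*-identityʳ (+ n))
  (ℚᵘ.drop-*≤* (ℚᵘ.≤-respˡ-≃ (ℚ.toℚᵘ-fromℚᵘ (ℚᵘ.mkℚᵘ (+ m) 0))
    (ℚᵘ.≤-respʳ-≃ (ℚ.toℚᵘ-fromℚᵘ (ℚᵘ.mkℚᵘ (+ n) 0))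
      (ℚ.toℚᵘ-mono-≤ (fromℚ-cancel-≤ _ _ m≤n))))))

fromℕ≥0 : ∀ n → 0ᴿ ≤ᴿ fromℕ n
fromℕ≥0 n = ≤ᴿ-pointwise {0ᴿ} {fromℕ n} λ _ → ℚ.nonNegative⁻¹ ((+ n) ℚ./ 1) {{ℚ.normalize-nonNeg n 1}}

unit*suc : ∀ k → unit k ℚ.* ((+ suc k) ℚ./ 1) ≡ 1ℚ
unit*suc k = ℚ.toℚᵘ-injective (ℚᵘ.≃-trans (ℚ.toℚᵘ-homo-* (unit k) ((+ suc k) ℚ./ 1))
  (ℚᵘ.≃-trans (ℚᵘ.*-cong (ℚᵘ.≃-refl {toℚᵘ (unit k)}) (ℚ.toℚᵘ-fromℚᵘ (ℚᵘ.mkℚᵘ (+ suc k) 0)))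
    (ℚᵘ.*≡* (trans (ℤ.*-identityʳ _) (trans (ℤ.*-identityˡ (+ suc k))
      (trans (cong +_ (sym (ℕ.*-identityʳ (suc k)))) (sym (ℤ.*-identityˡ _))))))))

-- Complex numbers

infix 4 _≋_

-- A record, so that both sides can be inferred from a proof.
record _≋_ (z w : ℂ) : Set where
  constructor [_]
  field ≋⇒≈ : z ≈ᶜ w
open _≋_ public

≋-pointwise : ∀ {z w} → (∀ n → seq (re z) n ≡ seq (re w) n) →
  (∀ n → seq (im z) n ≡ seq (im w) n) → z ≋ w
≋-pointwise {z} {w} p q =
  [ ≈ᴿ-pointwise {re z} {re w} p , ≈ᴿ-pointwise {im z} {im w} q ]

≋-refl : ∀ {z} → z ≋ z
≋-refl = ≋-pointwise (λ _ → refl) (λ _ → refl)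

≋-sym : ∀ {z w} → z ≋ w → w ≋ z
≋-sym {z} {w} [ p , q ] = [ ≈ᴿ-sym {re z} {re w} p , ≈ᴿ-sym {im z} {im w} q ]

≋-trans : ∀ {z w u} → z ≋ w → w ≋ u → z ≋ u
≋-trans {z} {w} {u} [ p , q ] [ p′ , q′ ] =
  [ ≈ᴿ-trans {re z} {re w} {re u} p p′ , ≈ᴿ-trans {im z} {im w} {im u} q q′ ]

≋-stable : ∀ {z w} → ¬ ¬ (z ≋ w) → z ≋ w
≋-stable {z} {w} h =
  [ ≈ᴿ-stable {re z} {re w} (λ k → h λ e → k (proj₁ (≋⇒≈ e)))
  , ≈ᴿ-stable {im z} {im w} (λ k → h λ e → k (proj₂ (≋⇒≈ e))) ]

+ᶜ-cong : ∀ {z z′ w w′} → z ≋ z′ → w ≋ w′ → z +ᶜ w ≋ z′ +ᶜ w′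
+ᶜ-cong {z} {z′} {w} {w′} [ p , q ] [ p′ , q′ ] =
  [ +ᴿ-cong {re z} {re z′} {re w} {re w′} p p′
  , +ᴿ-cong {im z} {im z′} {im w} {im w′} q q′ ]

*ᶜ-cong : ∀ {z z′ w w′} → z ≋ z′ → w ≋ w′ → z *ᶜ w ≋ z′ *ᶜ w′
*ᶜ-cong {z} {z′} {w} {w′} [ p , q ] [ p′ , q′ ] =
  [ +ᴿ-cong {re z *ᴿ re w} {re z′ *ᴿ re w′} { -ᴿ (im z *ᴿ im w)} { -ᴿ (im z′ *ᴿ im w′)}
      (*ᴿ-cong {re z} {re z′} {re w} {re w′} p p′)
      (-ᴿ-cong {im z *ᴿ im w} {im z′ *ᴿ im w′} (*ᴿ-cong {im z} {im z′} {im w} {im w′} q q′))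
  , +ᴿ-cong {re z *ᴿ im w} {re z′ *ᴿ im w′} {im z *ᴿ re w} {im z′ *ᴿ re w′}
      (*ᴿ-cong {re z} {re z′} {im w} {im w′} p q′)
      (*ᴿ-cong {im z} {im z′} {re w} {re w′} q p′) ]

+ᶜ-identityˡ : ∀ z → 0ᶜ +ᶜ z ≋ z
+ᶜ-identityˡ z = ≋-pointwise (λ n → ℚ.+-identityˡ (seq (re z) n)) (λ n → ℚ.+-identityˡ (seq (im z) n))

*ᶜ-comm : ∀ z w → z *ᶜ w ≋ w *ᶜ z
*ᶜ-comm z w = ≋-pointwise
  (λ n → solve 4 (λ a b c d → a :* c :+ :- (b :* d) := c :* a :+ :- (d :* b))
    refl (seq (re z) n) (seq (im z) n) (seq (re w) n) (seq (im w) n))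
  (λ n → solve 4 (λ a b c d → a :* d :+ b :* c := c :* b :+ d :* a)
    refl (seq (re z) n) (seq (im z) n) (seq (re w) n) (seq (im w) n))

*ᶜ-assoc : ∀ z w u → (z *ᶜ w) *ᶜ u ≋ z *ᶜ (w *ᶜ u)
*ᶜ-assoc z w u = ≋-pointwise
  (λ n → solve 6 (λ a b c d e f →
      (a :* c :+ :- (b :* d)) :* e :+ :- ((a :* d :+ b :* c) :* f)
      := a :* (c :* e :+ :- (d :* f)) :+ :- (b :* (c :* f :+ d :* e)))
    refl (seq (re z) n) (seq (im z) n) (seq (re w) n) (seq (im w) n) (seq (re u) n) (seq (im u) n))
  (λ n → solve 6 (λ a b c d e f →
      (a :* c :+ :- (b :* d)) :* f :+ (a :* d :+ b :* c) :* e
      := a :* (c :* f :+ d :* e) :+ b :* (c :* e :+ :- (d :* f)))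
    refl (seq (re z) n) (seq (im z) n) (seq (re w) n) (seq (im w) n) (seq (re u) n) (seq (im u) n))

*ᶜ-identityˡ : ∀ z → 1ᶜ *ᶜ z ≋ z
*ᶜ-identityˡ z = ≋-pointwise
  (λ n → solve 2 (λ a b → con 1ℚ :* a :+ :- (con 0ℚ :* b) := a) refl (seq (re z) n) (seq (im z) n))
  (λ n → solve 2 (λ a b → con 1ℚ :* b :+ con 0ℚ :* a := b) refl (seq (re z) n) (seq (im z) n))

*ᶜ-zeroˡ : ∀ z → 0ᶜ *ᶜ z ≋ 0ᶜ
*ᶜ-zeroˡ z = ≋-pointwise
  (λ n → solve 2 (λ a b → con 0ℚ :* a :+ :- (con 0ℚ :* b) := con 0ℚ) refl (seq (re z) n) (seq (im z) n))
  (λ n → solve 2 (λ a b → con 0ℚ :* b :+ con 0ℚ :* a := con 0ℚ) refl (seq (re z) n) (seq (im z) n))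

*ᶜ-commutativeMonoid : CommutativeMonoid 0ℓ 0ℓ
*ᶜ-commutativeMonoid = record
  { Carrier = ℂ ; _≈_ = _≋_ ; _∙_ = _*ᶜ_ ; ε = 1ᶜ
  ; isCommutativeMonoid = record
    { isMonoid = record
      { isSemigroup = record
        { isMagma = record
          { isEquivalence = record { refl = ≋-refl ; sym = ≋-sym ; trans = ≋-trans }
          ; ∙-cong = *ᶜ-cong }
        ; assoc = *ᶜ-assoc }
      ; identity = *ᶜ-identityˡ , λ z → ≋-trans (*ᶜ-comm z 1ᶜ) (*ᶜ-identityˡ z) }
    ; comm = *ᶜ-comm } }

open CommutativeSemigroupProperties (CommutativeMonoid.commutativeSemigroup *ᶜ-commutativeMonoid)
  using (x∙yz≈y∙xz; interchange)
module ≋-Reasoning = SetoidReasoning (CommutativeMonoid.setoid *ᶜ-commutativeMonoid)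

-- Norms, inner product and unimodular numbers

-ᶜ_ : ℂ → ℂ
-ᶜ z = (-ᴿ re z) +i (-ᴿ im z)

conj : ℂ → ℂ
conj z = re z +i (-ᴿ im z)

infixl 7 _·_
_·_ : ℝ → ℂ → ℂ
r · z = (r *ᴿ re z) +i (r *ᴿ im z)

-- Squared moduli are polynomial in the coordinates and so within reach of the ring solver; roots
-- enter only in translating to and from `∣_∣ᶜ`.
norm² : ℂ → ℝ
norm² z = re z *ᴿ re z +ᴿ im z *ᴿ im z

-- The real part of z times the conjugate of w, that is, the Euclidean inner product on the plane.
⟨_,_⟩ : ℂ → ℂ → ℝ
⟨ z , w ⟩ = re z *ᴿ re w +ᴿ im z *ᴿ im w

⟨⟩-cong : ∀ {z z′ w w′} → z ≋ z′ → w ≋ w′ → ⟨ z , w ⟩ ≈ᴿ ⟨ z′ , w′ ⟩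
⟨⟩-cong {z} {z′} {w} {w′} [ p , q ] [ p′ , q′ ] =
  +ᴿ-cong {re z *ᴿ re w} {re z′ *ᴿ re w′} {im z *ᴿ im w} {im z′ *ᴿ im w′}
    (*ᴿ-cong {re z} {re z′} {re w} {re w′} p p′)
    (*ᴿ-cong {im z} {im z′} {im w} {im w′} q q′)

·-assoc : ∀ r z w → (r · z) *ᶜ w ≋ r · (z *ᶜ w)
·-assoc r z w = ≋-pointwise
  (λ n → solve 5 (λ r a b c d → (r :* a) :* c :+ :- ((r :* b) :* d) := r :* (a :* c :+ :- (b :* d)))
    refl (seq r n) (seq (re z) n) (seq (im z) n) (seq (re w) n) (seq (im w) n))
  (λ n → solve 5 (λ r a b c d → (r :* a) :* d :+ (r :* b) :* c := r :* (a :* d :+ b :* c))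
    refl (seq r n) (seq (re z) n) (seq (im z) n) (seq (re w) n) (seq (im w) n))

norm²-cong : ∀ {z w} → z ≋ w → norm² z ≈ᴿ norm² w
norm²-cong e = ⟨⟩-cong e e

0≤norm²-pointwise : ∀ z n → 0ℚ ℚ.≤ seq (norm² z) n
0≤norm²-pointwise z n = ℚ.+-mono-≤ (0≤p*p (seq (re z) n)) (0≤p*p (seq (im z) n))

0≤norm² : ∀ z → 0ᴿ ≤ᴿ norm² z
0≤norm² z = ≤ᴿ-pointwise {0ᴿ} {norm² z} (0≤norm²-pointwise z)

-- The two-square identity of Brahmagupta and Fibonacci, at every index.
norm²-* : ∀ z w → norm² (z *ᶜ w) ≈ᴿ norm² z *ᴿ norm² w
norm²-* z w = ≈ᴿ-pointwise {norm² (z *ᶜ w)} {norm² z *ᴿ norm² w} λ n →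
  solve 4 (λ a b c d → let p = a :* c :+ :- (b :* d) ; q = a :* d :+ b :* c in
      p :* p :+ q :* q := (a :* a :+ b :* b) :* (c :* c :+ d :* d))
    refl (seq (re z) n) (seq (im z) n) (seq (re w) n) (seq (im w) n)

norm²-conj : ∀ z → norm² (conj z) ≈ᴿ norm² z
norm²-conj z = ≈ᴿ-pointwise {norm² (conj z)} {norm² z} λ n →
  solve 2 (λ a b → a :* a :+ (:- b) :* (:- b) := a :* a :+ b :* b) refl (seq (re z) n) (seq (im z) n)

norm²-· : ∀ r z → norm² (r · z) ≈ᴿ (r *ᴿ r) *ᴿ norm² z
norm²-· r z = ≈ᴿ-pointwise {norm² (r · z)} {(r *ᴿ r) *ᴿ norm² z} λ n →
  solve 3 (λ r a b → (r :* a) :* (r :* a) :+ (r :* b) :* (r :* b) := (r :* r) :* (a :* a :+ b :* b))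
    refl (seq r n) (seq (re z) n) (seq (im z) n)

norm²≤0⇒≋0 : ∀ z → norm² z ≤ᴿ 0ᴿ → z ≋ 0ᶜ
norm²≤0⇒≋0 z N≤0 =
  [ square-cancel-≈0 (re z) (≤ᴿ-trans {re z *ᴿ re z} {norm² z} {0ᴿ}
      (≤ᴿ-pointwise {re z *ᴿ re z} {norm² z} λ n →
        ≤-shift (0≤p*p (seq (im z) n)) (solve 2 (λ a b → b :- con 0ℚ := (a :+ b) :- a) refl
          (seq (re z) n ℚ.* seq (re z) n) (seq (im z) n ℚ.* seq (im z) n))) N≤0)
  , square-cancel-≈0 (im z) (≤ᴿ-trans {im z *ᴿ im z} {norm² z} {0ᴿ}
      (≤ᴿ-pointwise {im z *ᴿ im z} {norm² z} λ n →
        ≤-shift (0≤p*p (seq (re z) n)) (solve 2 (λ a b → a :- con 0ℚ := (a :+ b) :- b) refl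
          (seq (re z) n ℚ.* seq (re z) n) (seq (im z) n ℚ.* seq (im z) n))) N≤0) ]

norm²≤0⇒≋ : ∀ z w → norm² (z +ᶜ -ᶜ w) ≤ᴿ 0ᴿ → z ≋ w
norm²≤0⇒≋ z w N≤0 = ≋-trans
  (≋-pointwise
    (λ n → solve 2 (λ a b → a := (a :+ :- b) :+ b) refl (seq (re z) n) (seq (re w) n))
    (λ n → solve 2 (λ a b → a := (a :+ :- b) :+ b) refl (seq (im z) n) (seq (im w) n)))
  (≋-trans (+ᶜ-cong (norm²≤0⇒≋0 (z +ᶜ -ᶜ w) N≤0) (≋-refl {w})) (+ᶜ-identityˡ w))

-- |u|² |z - w|² = |zu - wu|² = 0, so cancelling the real factor |u|² gives z = w without inverting
-- u.
*ᶜ-cancelʳ : ∀ z w u → ¬ (norm² u ≤ᴿ 0ᴿ) → z *ᶜ u ≋ w *ᶜ u → z ≋ w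
*ᶜ-cancelʳ z w u u≰0 e = norm²≤0⇒≋ z w (*ᴿ-cancelˡ-≤ (norm² u) (norm² (z +ᶜ -ᶜ w)) 0ᴿ u≰0
  (≤ᴿ-trans {norm² u *ᴿ norm² (z +ᶜ -ᶜ w)} {norm² ((z *ᶜ u) +ᶜ -ᶜ (w *ᶜ u))} {norm² u *ᴿ 0ᴿ}
    (≤ᴿ-pointwise {norm² u *ᴿ norm² (z +ᶜ -ᶜ w)} {norm² ((z *ᶜ u) +ᶜ -ᶜ (w *ᶜ u))}
      (λ n → ℚ.≤-reflexive (solve 6 (λ a b c d e f →
        let p = (a :* e :+ :- (b :* f)) :+ :- (c :* e :+ :- (d :* f))
            q = (a :* f :+ b :* e) :+ :- (c :* f :+ d :* e)
            r = a :+ :- c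
            s = b :+ :- d
        in (e :* e :+ f :* f) :* (r :* r :+ s :* s) := p :* p :+ q :* q)
        refl (seq (re z) n) (seq (im z) n) (seq (re w) n) (seq (im w) n) (seq (re u) n) (seq (im u) n))))
    (≈⇒≤ {norm² ((z *ᶜ u) +ᶜ -ᶜ (w *ᶜ u))} {norm² u *ᴿ 0ᴿ}
      (≈ᴿ-trans {norm² ((z *ᶜ u) +ᶜ -ᶜ (w *ᶜ u))} {norm² ((w *ᶜ u) +ᶜ -ᶜ (w *ᶜ u))} {norm² u *ᴿ 0ᴿ}
        (norm²-cong (+ᶜ-cong e (≋-refl { -ᶜ (w *ᶜ u)})))
        (≈ᴿ-pointwise {norm² ((w *ᶜ u) +ᶜ -ᶜ (w *ᶜ u))} {norm² u *ᴿ 0ᴿ} λ n →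
          solve 3 (λ a b r → (a :+ :- a) :* (a :+ :- a) :+ (b :+ :- b) :* (b :+ :- b) := r :* con 0ℚ)
            refl (seq (re (w *ᶜ u)) n) (seq (im (w *ᶜ u)) n) (seq (norm² u) n))))))

norm²-via-modulus : ∀ z → (∣ z ∣ᶜ *ᴿ ∣ z ∣ᶜ) ≈ᴿ norm² z
norm²-via-modulus z = √-square (norm² z) (0≤norm²-pointwise z)

modulus≈⇒norm²≈ : ∀ z r → ∣ z ∣ᶜ ≈ᴿ r → norm² z ≈ᴿ r *ᴿ r
modulus≈⇒norm²≈ z r e = ≈ᴿ-trans {norm² z} {∣ z ∣ᶜ *ᴿ ∣ z ∣ᶜ} {r *ᴿ r}
  (≈ᴿ-sym {∣ z ∣ᶜ *ᴿ ∣ z ∣ᶜ} {norm² z} (norm²-via-modulus z))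
  (*ᴿ-cong {∣ z ∣ᶜ} {r} {∣ z ∣ᶜ} {r} e e)

norm²≤⇒modulus≤ : ∀ z r → 0ᴿ ≤ᴿ r → norm² z ≤ᴿ r *ᴿ r → ∣ z ∣ᶜ ≤ᴿ r
norm²≤⇒modulus≤ z r 0≤r N≤r² = square-cancelᴿ-≤ ∣ z ∣ᶜ r 0≤r
  (≤ᴿ-trans {∣ z ∣ᶜ *ᴿ ∣ z ∣ᶜ} {norm² z} {r *ᴿ r}
    (≈⇒≤ {∣ z ∣ᶜ *ᴿ ∣ z ∣ᶜ} {norm² z} (norm²-via-modulus z)) N≤r²)

norm²≈⇒modulus≈ : ∀ z r → 0ᴿ ≤ᴿ r → norm² z ≈ᴿ r *ᴿ r → ∣ z ∣ᶜ ≈ᴿ r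
norm²≈⇒modulus≈ z r 0≤r N≈r² = ≤ᴿ-antisym {∣ z ∣ᶜ} {r}
  (norm²≤⇒modulus≤ z r 0≤r (≈⇒≤ {norm² z} {r *ᴿ r} N≈r²))
  (square-cancelᴿ-≤ r ∣ z ∣ᶜ (√-nonNeg (norm² z))
    (≤ᴿ-trans {r *ᴿ r} {norm² z} {∣ z ∣ᶜ *ᴿ ∣ z ∣ᶜ} (≈⇒≥ {norm² z} {r *ᴿ r} N≈r²)
      (≈⇒≥ {∣ z ∣ᶜ *ᴿ ∣ z ∣ᶜ} {norm² z} (norm²-via-modulus z))))

1ᴿ*1ᴿ≈1ᴿ : (1ᴿ *ᴿ 1ᴿ) ≈ᴿ 1ᴿ
1ᴿ*1ᴿ≈1ᴿ = ≈ᴿ-pointwise {1ᴿ *ᴿ 1ᴿ} {1ᴿ} (λ _ → refl)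

Unimodular : ℂ → Set
Unimodular z = norm² z ≈ᴿ 1ᴿ

𝕋-unimodular : ∀ μ → Unimodular (val μ)
𝕋-unimodular μ = ≈ᴿ-trans {norm² (val μ)} {1ᴿ *ᴿ 1ᴿ} {1ᴿ}
  (modulus≈⇒norm²≈ (val μ) 1ᴿ (modulus μ)) 1ᴿ*1ᴿ≈1ᴿ

unimodular-𝕋 : ∀ z → Unimodular z → 𝕋
unimodular-𝕋 z e = record
  { val = z
  ; modulus = norm²≈⇒modulus≈ z 1ᴿ (≤ᴿ-pointwise {0ᴿ} {1ᴿ} λ _ → ℚ.nonNegative⁻¹ 1ℚ)
      (≈ᴿ-trans {norm² z} {1ᴿ} {1ᴿ *ᴿ 1ᴿ} e (≈ᴿ-sym {1ᴿ *ᴿ 1ᴿ} {1ᴿ} 1ᴿ*1ᴿ≈1ᴿ)) }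

unimodular-1 : Unimodular 1ᶜ
unimodular-1 = ≈ᴿ-pointwise {norm² 1ᶜ} {1ᴿ} (λ _ → refl)

unimodular-norm²-* : ∀ z w → Unimodular z → norm² (z *ᶜ w) ≈ᴿ norm² w
unimodular-norm²-* z w e = ≈ᴿ-trans {norm² (z *ᶜ w)} {norm² z *ᴿ norm² w} {norm² w} (norm²-* z w)
  (≈ᴿ-trans {norm² z *ᴿ norm² w} {1ᴿ *ᴿ norm² w} {norm² w}
    (*ᴿ-cong {norm² z} {1ᴿ} {norm² w} {norm² w} e (≈ᴿ-refl {norm² w}))
    (≈ᴿ-pointwise {1ᴿ *ᴿ norm² w} {norm² w} λ n → ℚ.*-identityˡ _))

unimodular-* : ∀ {z w} → Unimodular z → Unimodular w → Unimodular (z *ᶜ w)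
unimodular-* {z} {w} e f = ≈ᴿ-trans {norm² (z *ᶜ w)} {norm² w} {1ᴿ} (unimodular-norm²-* z w e) f

unimodular-conj : ∀ {z} → Unimodular z → Unimodular (conj z)
unimodular-conj {z} e = ≈ᴿ-trans {norm² (conj z)} {norm² z} {1ᴿ} (norm²-conj z) e

unimodular-inverse : ∀ {z} → Unimodular z → z *ᶜ conj z ≋ 1ᶜ
unimodular-inverse {z} e =
  [ ≈ᴿ-trans {re (z *ᶜ conj z)} {norm² z} {1ᴿ}
      (≈ᴿ-pointwise {re (z *ᶜ conj z)} {norm² z} λ n →
        solve 2 (λ a b → a :* a :+ :- (b :* :- b) := a :* a :+ b :* b)
          refl (seq (re z) n) (seq (im z) n)) e
  , ≈ᴿ-pointwise {im (z *ᶜ conj z)} {0ᴿ} (λ n →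
      solve 2 (λ a b → a :* :- b :+ b :* a := con 0ℚ) refl (seq (re z) n) (seq (im z) n)) ]

-- Sums over an out-neighbourhood

if-arc : Bool → ℝ → ℝ
if-arc true  r = r
if-arc false r = 0ᴿ

-- The slack of the main estimate: if it is at most 0, every marked term equals c.
deviation : (Fin n → Bool) → Vector ℂ n → ℂ → ℝ
deviation {zero}  b t c = 0ᴿ
deviation {suc n} b t c =
  if-arc (b zero) (norm² (t zero +ᶜ -ᶜ c)) +ᴿ deviation (b ∘ suc) (t ∘ suc) c

0≤if-arc : ∀ β z → 0ᴿ ≤ᴿ if-arc β (norm² z)
0≤if-arc true  z = 0≤norm² z
0≤if-arc false z = ≤ᴿ-refl {0ᴿ}

0≤deviation : ∀ (b : Fin n → Bool) t c → 0ᴿ ≤ᴿ deviation b t c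
0≤deviation {zero}  b t c = ≤ᴿ-refl {0ᴿ}
0≤deviation {suc n} b t c =
  +ᴿ-mono-≤ {0ᴿ} {if-arc (b zero) (norm² (t zero +ᶜ -ᶜ c))} {0ᴿ} {deviation (b ∘ suc) (t ∘ suc) c}
    (0≤if-arc (b zero) (t zero +ᶜ -ᶜ c)) (0≤deviation (b ∘ suc) (t ∘ suc) c)

norm²≤deviation : ∀ (b : Fin n → Bool) t c k → T (b k) → norm² (t k +ᶜ -ᶜ c) ≤ᴿ deviation b t c
norm²≤deviation {suc n} b t c zero bk with b zero
... | true = ≤ᴿ-shift 0ᴿ rest N (N +ᴿ rest) (0≤deviation (b ∘ suc) (t ∘ suc) c) λ n →
    solve 2 (λ a b → b :- con 0ℚ := (a :+ b) :- a) refl (seq N n) (seq rest n)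
  where
  N rest : ℝ
  N = norm² (t zero +ᶜ -ᶜ c)
  rest = deviation (b ∘ suc) (t ∘ suc) c
norm²≤deviation {suc n} b t c (suc k) bk = ≤ᴿ-trans {N} {rest} {first +ᴿ rest}
  (norm²≤deviation (b ∘ suc) (t ∘ suc) c k bk)
  (≤ᴿ-shift 0ᴿ first rest (first +ᴿ rest) (0≤if-arc (b zero) (t zero +ᶜ -ᶜ c)) λ n →
    solve 2 (λ a b → a :- con 0ℚ := (a :+ b) :- b) refl (seq first n) (seq rest n))
  where
  N first rest : ℝ
  N = norm² (t (suc k) +ᶜ -ᶜ c)
  first = if-arc (b zero) (norm² (t zero +ᶜ -ᶜ c))
  rest = deviation (b ∘ suc) (t ∘ suc) c

-- Expanding each square |tⱼ - c|² gives equality up to the slack in |tⱼ|² ≤ M.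
deviation-bound : ∀ (b : Fin n → Bool) t c M → (∀ j → T (b j) → norm² (t j) ≤ᴿ M) →
  (∀ j → ¬ T (b j) → t j ≋ 0ᶜ) →
  (deviation b t c +ᴿ (⟨ c , ∑ᶜ t ⟩ +ᴿ ⟨ c , ∑ᶜ t ⟩))
    ≤ᴿ (fromℕ ∣ Vec.tabulate b ∣ *ᴿ (M +ᴿ norm² c))
deviation-bound {zero} b t c M t≤M t≈0 = ≤ᴿ-pointwise
  {deviation b t c +ᴿ (⟨ c , ∑ᶜ t ⟩ +ᴿ ⟨ c , ∑ᶜ t ⟩)} {fromℕ 0 *ᴿ (M +ᴿ norm² c)}
  λ n → ℚ.≤-reflexive (solve 3 (λ a b m →
    let p = a :* con 0ℚ :+ b :* con 0ℚ in con 0ℚ :+ (p :+ p) := con 0ℚ :* m)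
    refl (seq (re c) n) (seq (im c) n) (seq (M +ᴿ norm² c) n))
deviation-bound {suc n} b t c M t≤M t≈0 = cons (b zero) (t zero)
  (deviation (b ∘ suc) (t ∘ suc) c) (∑ᶜ (t ∘ suc))
  ∣ Vec.tabulate (b ∘ suc) ∣ (t≤M zero) (t≈0 zero)
  (deviation-bound (b ∘ suc) (t ∘ suc) c M (t≤M ∘ suc) (t≈0 ∘ suc))
  where
  2⟨c,_⟩ : ℂ → ℝ
  2⟨c, z ⟩ = ⟨ c , z ⟩ +ᴿ ⟨ c , z ⟩
  -- The head is generalised to β so that one case split reaches all its occurrences; the `if` is
  -- what the cardinality of a subset with head β unfolds to.
  cons : ∀ β t₀ D s d → (T β → norm² t₀ ≤ᴿ M) → (¬ T β → t₀ ≋ 0ᶜ) →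
    (D +ᴿ 2⟨c, s ⟩) ≤ᴿ (fromℕ d *ᴿ (M +ᴿ norm² c)) →
    ((if-arc β (norm² (t₀ +ᶜ -ᶜ c)) +ᴿ D) +ᴿ 2⟨c, t₀ +ᶜ s ⟩)
      ≤ᴿ (fromℕ ((if does (β ≟ᵇ true) then suc else id) d) *ᴿ (M +ᴿ norm² c))
  cons true t₀ D s d t₀≤M _ ih = subst
    (λ q → ((norm² (t₀ +ᶜ -ᶜ c) +ᴿ D) +ᴿ 2⟨c, t₀ +ᶜ s ⟩) ≤ᴿ (fromℚ q *ᴿ (M +ᴿ norm² c)))
    (sym (fromℕ-suc d))
    (≤ᴿ-shift (norm² t₀ +ᴿ (D +ᴿ 2⟨c, s ⟩)) (M +ᴿ (fromℕ d *ᴿ (M +ᴿ norm² c)))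
      ((norm² (t₀ +ᶜ -ᶜ c) +ᴿ D) +ᴿ 2⟨c, t₀ +ᶜ s ⟩)
      (fromℚ (1ℚ ℚ.+ (+ d) ℚ./ 1) *ᴿ (M +ᴿ norm² c))
      (+ᴿ-mono-≤ {norm² t₀} {M} {D +ᴿ 2⟨c, s ⟩} {fromℕ d *ᴿ (M +ᴿ norm² c)} (t₀≤M tt) ih)
      λ n → solve 9 (λ a b p q u v D M d →
          let N = a :* a :+ b :* b
              in₁ = a :* u :+ b :* v
              in₂ = a :* (p :+ u) :+ b :* (q :+ v)
          in (M :+ d :* (M :+ N)) :- ((p :* p :+ q :* q) :+ (D :+ (in₁ :+ in₁)))
             := (con 1ℚ :+ d) :* (M :+ N)
                :- ((((p :+ :- a) :* (p :+ :- a) :+ (q :+ :- b) :* (q :+ :- b)) :+ D) :+ (in₂ :+ in₂)))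
        refl (seq (re c) n) (seq (im c) n) (seq (re t₀) n) (seq (im t₀) n) (seq (re s) n) (seq (im s) n)
        (seq D n) (seq M n) ((+ d) ℚ./ 1))
  cons false t₀ D s d _ t₀≈0 ih = ≤ᴿ-trans {(0ᴿ +ᴿ D) +ᴿ 2⟨c, t₀ +ᶜ s ⟩} {D +ᴿ 2⟨c, s ⟩} {R}
    (≈⇒≤ {(0ᴿ +ᴿ D) +ᴿ 2⟨c, t₀ +ᶜ s ⟩} {D +ᴿ 2⟨c, s ⟩}
      (+ᴿ-cong {0ᴿ +ᴿ D} {D} {2⟨c, t₀ +ᶜ s ⟩} {2⟨c, s ⟩}
        (≈ᴿ-pointwise {0ᴿ +ᴿ D} {D} λ n → ℚ.+-identityˡ _)
        (+ᴿ-cong {⟨ c , t₀ +ᶜ s ⟩} {⟨ c , s ⟩} {⟨ c , t₀ +ᶜ s ⟩} {⟨ c , s ⟩} e e)))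
    ih
    where
    R : ℝ
    R = fromℕ d *ᴿ (M +ᴿ norm² c)
    e : ⟨ c , t₀ +ᶜ s ⟩ ≈ᴿ ⟨ c , s ⟩
    e = ⟨⟩-cong (≋-refl {c}) (≋-trans (+ᶜ-cong (t₀≈0 id) ≋-refl) (+ᶜ-identityˡ s))

∑ᶜ-constant : ∀ (b : Fin n → Bool) t z → (∀ j → T (b j) → t j ≋ z) →
  (∀ j → ¬ T (b j) → t j ≋ 0ᶜ) → ∑ᶜ t ≋ fromℕ ∣ Vec.tabulate b ∣ · z
∑ᶜ-constant {zero} b t z t≈z t≈0 = ≋-pointwise
  (λ n → sym (ℚ.*-zeroˡ (seq (re z) n))) (λ n → sym (ℚ.*-zeroˡ (seq (im z) n)))
∑ᶜ-constant {suc n} b t z t≈z t≈0 = cons (b zero) (t zero) (∑ᶜ (t ∘ suc))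
  ∣ Vec.tabulate (b ∘ suc) ∣ (t≈z zero) (t≈0 zero)
  (∑ᶜ-constant (b ∘ suc) (t ∘ suc) z (t≈z ∘ suc) (t≈0 ∘ suc))
  where
  cons : ∀ β t₀ s d → (T β → t₀ ≋ z) → (¬ T β → t₀ ≋ 0ᶜ) → s ≋ fromℕ d · z →
    t₀ +ᶜ s ≋ fromℕ ((if does (β ≟ᵇ true) then suc else id) d) · z
  cons true t₀ s d t₀≈z _ ih = subst (λ q → t₀ +ᶜ s ≋ fromℚ q · z) (sym (fromℕ-suc d))
    (≋-trans (+ᶜ-cong (t₀≈z tt) ih) (≋-pointwise
      (λ n → solve 2 (λ a d → a :+ d :* a := (con 1ℚ :+ d) :* a) refl (seq (re z) n) ((+ d) ℚ./ 1))
      (λ n → solve 2 (λ a d → a :+ d :* a := (con 1ℚ :+ d) :* a) refl (seq (im z) n) ((+ d) ℚ./ 1))))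
  cons false t₀ s d _ t₀≈0 ih = ≋-trans (+ᶜ-cong (t₀≈0 id) ih) (+ᶜ-identityˡ (fromℕ d · z))

-- Gain digraphs

1ᴿ≰0ᴿ : ¬ (1ᴿ ≤ᴿ 0ᴿ)
1ᴿ≰0ᴿ 1≤0 = ℚ.<-irrefl refl (ℚ.<-≤-trans (ℚ.positive⁻¹ 1ℚ) (fromℚ-cancel-≤ 1ℚ 0ℚ 1≤0))

-- Entries of maximal modulus

-- Each induction step compares the new entry with the previous maximum. That comparison of reals
-- cannot be decided, whence the double negation.
¬¬-argmax : ∀ {n} (f : Fin (suc n) → ℝ) → ¬ ¬ (∃[ i ] ∀ j → f j ≤ᴿ f i)
¬¬-argmax {zero} f k = k (zero , λ { zero → ≤ᴿ-refl {f zero} })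
¬¬-argmax {suc n} f k = ¬¬-argmax (f ∘ suc) λ (i , f≤fi) →
  let f0≰fi : ¬ (f zero ≤ᴿ f (suc i))
      f0≰fi f0≤fi = k (suc i , λ { zero → f0≤fi ; (suc j) → f≤fi j })
  in k (zero , λ { zero → ≤ᴿ-refl {f zero}
                 ; (suc j) → ≤ᴿ-trans {f (suc j)} {f (suc i)} {f zero}
                               (f≤fi j) (≰⇒≥ {f zero} {f (suc i)} f0≰fi) })

-- The second component permits cancelling |xᵢ|². As a negation it follows from x being nonzero,
-- with no positive lower bound exhibited.
Extremal : ∀ {n} → Vector ℂ n → Fin n → Set
Extremal x i = (∀ j → norm² (x j) ≤ᴿ norm² (x i)) × ¬ (norm² (x i) ≤ᴿ 0ᴿ)

¬¬-extremal : ∀ {n} (x : Vector ℂ n) → ¬ (∀ i → x i ≈ᶜ 0ᶜ) → ¬ ¬ (∃[ i ] Extremal x i)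
¬¬-extremal {zero}  x x≉0 k = x≉0 (λ ())
¬¬-extremal {suc n} x x≉0 k = ¬¬-argmax (norm² ∘ x) λ (i , x≤xi) →
  k (i , x≤xi , λ xi≤0 → x≉0 λ j → ≋⇒≈ (norm²≤0⇒≋0 (x j)
    (≤ᴿ-trans {norm² (x j)} {norm² (x i)} {0ᴿ} (x≤xi j) xi≤0)))

^ᶜ-conj : ∀ z k → Unimodular z → (z ^ᶜ k) *ᶜ (conj z ^ᶜ k) ≋ 1ᶜ
^ᶜ-conj z zero    e = *ᶜ-identityˡ 1ᶜ
^ᶜ-conj z (suc k) e = ≋-trans (interchange z (z ^ᶜ k) (conj z) (conj z ^ᶜ k))
  (≋-trans (*ᶜ-cong (unimodular-inverse {z} e) (^ᶜ-conj z k e)) (*ᶜ-identityˡ 1ᶜ))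

divide-by-suc : ∀ k z → z ≋ fromℕ (suc k) · (fromℚ (unit k) · z)
divide-by-suc k z = ≋-pointwise (λ n → scale (seq (re z) n)) (λ n → scale (seq (im z) n))
  where
  scale : ∀ q → q ≡ ((+ suc k) ℚ./ 1) ℚ.* (unit k ℚ.* q)
  scale q = trans (sym (ℚ.*-identityˡ q)) (trans (cong (ℚ._* q) (sym (unit*suc k)))
    (solve 3 (λ u r q → u :* r :* q := r :* (u :* q)) refl (unit k) ((+ suc k) ℚ./ 1) q))

T⇒0<∣tabulate∣ : ∀ {n} (b : Fin n → Bool) k → T (b k) → 0 ℕ.< ∣ Vec.tabulate b ∣
T⇒0<∣tabulate∣ b zero bk with b zero
... | true = s≤s z≤n
T⇒0<∣tabulate∣ b (suc k) bk with b zero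
... | true  = s≤s z≤n
... | false = T⇒0<∣tabulate∣ (b ∘ suc) k bk

module Gains {n : ℕ} (Φ : GainDigraph n) where
  open GainDigraph Φ

  -- Proofs of `Arc i j` are unique, so the arc found by the decision procedure has the gain of a.
  adjacency-arc : ∀ {i j} (a : Arc i j) → adjacency i j ≡ val (φ a)
  adjacency-arc {i} {j} a with T? (arc i j)
  ... | yes a′ = cong (λ a → val (φ a)) (T-irrelevant a′ a)
  ... | no ¬a  = ⊥-elim (¬a a)

  adjacency-nonarc : ∀ {i j} → ¬ Arc i j → adjacency i j ≡ 0ᶜ
  adjacency-nonarc {i} {j} ¬a with T? (arc i j)
  ... | yes a = ⊥-elim (¬a a)
  ... | no _  = refl

  row : Vector ℂ n → Fin n → Vector ℂ n
  row x i j = adjacency i j *ᶜ x j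

  row-arc : ∀ x {i j} (a : Arc i j) → row x i j ≋ val (φ a) *ᶜ x j
  row-arc x {i} {j} a = subst (λ z → row x i j ≋ z *ᶜ x j) (adjacency-arc a) ≋-refl

  row-nonarc : ∀ x {i j} → ¬ Arc i j → row x i j ≋ 0ᶜ
  row-nonarc x {i} {j} ¬a = subst (λ z → z *ᶜ x j ≋ 0ᶜ) (sym (adjacency-nonarc ¬a)) (*ᶜ-zeroˡ (x j))

  norm²-row : ∀ x {i j} → Arc i j → norm² (row x i j) ≈ᴿ norm² (x j)
  norm²-row x {i} {j} a = ≈ᴿ-trans {norm² (row x i j)} {norm² (val (φ a) *ᶜ x j)} {norm² (x j)}
    (norm²-cong (row-arc x a)) (unimodular-norm²-* (val (φ a)) (x j) (𝕋-unimodular (φ a)))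

  deg⁺≤Δ⁺ : ∀ v → deg⁺ v ℕ.≤ Δ⁺
  deg⁺≤Δ⁺ = tabulate⁻ (xs≤max 0 (List.tabulate deg⁺))

  -- The estimate in the row of an extremal entry

  module Eigenvector (ev : ℂ) (x : Vector ℂ n)
    (eigen : ∀ i → ∑ᶜ (row x i) ≈ᶜ ev *ᶜ x i) where

    row-deviation : Fin n → ℂ → ℝ
    row-deviation i c = deviation (arc i) (row x i) c

    -- Gains are unimodular, so each term of the row has modulus |xⱼ| ≤ |xᵢ|, and the row sums to
    -- `ev *ᶜ x i`. Nothing is divided by `Δ⁺`, so the bound also serves when `Δ⁺` is 0.
    row-deviation-bound : ∀ i → Extremal x i → ∀ c →
      (row-deviation i c +ᴿ (⟨ c , ev *ᶜ x i ⟩ +ᴿ ⟨ c , ev *ᶜ x i ⟩))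
        ≤ᴿ (fromℕ (deg⁺ i) *ᴿ (norm² (x i) +ᴿ norm² c))
    row-deviation-bound i (x≤xi , _) c =
      ≤ᴿ-trans {D +ᴿ (q +ᴿ q)} {D +ᴿ (p +ᴿ p)} {fromℕ (deg⁺ i) *ᴿ (norm² (x i) +ᴿ norm² c)}
        (≈⇒≤ {D +ᴿ (q +ᴿ q)} {D +ᴿ (p +ᴿ p)}
          (+ᴿ-cong {D} {D} {q +ᴿ q} {p +ᴿ p} (≈ᴿ-refl {D}) (+ᴿ-cong {q} {p} {q} {p} q≈p q≈p)))
        (deviation-bound (arc i) (row x i) c (norm² (x i))
          (λ j a → ≤ᴿ-trans {norm² (row x i j)} {norm² (x j)} {norm² (x i)}
            (≈⇒≤ {norm² (row x i j)} {norm² (x j)} (norm²-row x a)) (x≤xi j))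
          (λ j ¬a → row-nonarc x ¬a))
      where
      D p q : ℝ
      D = row-deviation i c
      p = ⟨ c , ∑ᶜ (row x i) ⟩
      q = ⟨ c , ev *ᶜ x i ⟩
      q≈p : q ≈ᴿ p
      q≈p = ⟨⟩-cong {c} {c} {ev *ᶜ x i} {∑ᶜ (row x i)} ≋-refl (≋-sym [ eigen i ])

    module Scaled (ν : ℂ) (ev≋Δν : ev ≋ fromℕ Δ⁺ · ν) where

      Δ : ℝ
      Δ = fromℕ Δ⁺

      -- For c = νxᵢ the row sum is Δc, so its inner product with c is Δ|c|². The parameter m allows
      -- |c|² to be supplied in whichever equal form is convenient.
      scaled-deviation-bound : ∀ i → Extremal x i → ∀ m → norm² (ν *ᶜ x i) ≈ᴿ m →
        (row-deviation i (ν *ᶜ x i) +ᴿ (Δ *ᴿ m +ᴿ Δ *ᴿ m))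
          ≤ᴿ (fromℕ (deg⁺ i) *ᴿ (norm² (x i) +ᴿ m))
      scaled-deviation-bound i ext m N≈m =
        ≤ᴿ-trans {D +ᴿ (q +ᴿ q)} {D +ᴿ (p +ᴿ p)} {d *ᴿ (norm² (x i) +ᴿ m)}
          (≈⇒≤ {D +ᴿ (q +ᴿ q)} {D +ᴿ (p +ᴿ p)}
            (+ᴿ-cong {D} {D} {q +ᴿ q} {p +ᴿ p} (≈ᴿ-refl {D}) (+ᴿ-cong {q} {p} {q} {p} q≈p q≈p)))
          (≤ᴿ-trans {D +ᴿ (p +ᴿ p)} {d *ᴿ (norm² (x i) +ᴿ norm² c)} {d *ᴿ (norm² (x i) +ᴿ m)}
            (row-deviation-bound i ext c)
            (≈⇒≤ {d *ᴿ (norm² (x i) +ᴿ norm² c)} {d *ᴿ (norm² (x i) +ᴿ m)}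
              (*ᴿ-cong {d} {d} {norm² (x i) +ᴿ norm² c} {norm² (x i) +ᴿ m} (≈ᴿ-refl {d})
                (+ᴿ-cong {norm² (x i)} {norm² (x i)} {norm² c} {m} (≈ᴿ-refl {norm² (x i)}) N≈m))))
        where
        c : ℂ
        c = ν *ᶜ x i
        D p q d : ℝ
        D = row-deviation i c
        p = ⟨ c , ev *ᶜ x i ⟩
        q = Δ *ᴿ m
        d = fromℕ (deg⁺ i)
        p≈q : p ≈ᴿ q
        p≈q = ≈ᴿ-trans {p} {⟨ c , Δ · c ⟩} {q}
          (⟨⟩-cong (≋-refl {c}) (≋-trans (*ᶜ-cong ev≋Δν ≋-refl) (·-assoc Δ ν (x i))))
          (≈ᴿ-trans {⟨ c , Δ · c ⟩} {Δ *ᴿ norm² c} {q}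
            (≈ᴿ-pointwise {⟨ c , Δ · c ⟩} {Δ *ᴿ norm² c} λ k →
              solve 3 (λ r a b → a :* (r :* a) :+ b :* (r :* b) := r :* (a :* a :+ b :* b))
                refl (seq Δ k) (seq (re c) k) (seq (im c) k))
            (*ᴿ-cong {Δ} {Δ} {norm² c} {m} (≈ᴿ-refl {Δ}) N≈m))
        q≈p : q ≈ᴿ p
        q≈p = ≈ᴿ-sym {p} {q} p≈q

      -- The case of equality, |ν| = 1

      module Tight (Nν≈1 : Unimodular ν) where

        extremal-bound : ∀ i → Extremal x i → (row-deviation i (ν *ᶜ x i) +ᴿ
          (Δ *ᴿ norm² (x i) +ᴿ Δ *ᴿ norm² (x i))) ≤ᴿ (fromℕ (deg⁺ i) *ᴿ (norm² (x i) +ᴿ norm² (x i)))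
        extremal-bound i ext = scaled-deviation-bound i ext (norm² (x i)) (unimodular-norm²-* ν (x i) Nν≈1)

        -- Dropping the nonnegative deviation leaves 2Δ|xᵢ|² ≤ 2 deg⁺(i) |xᵢ|², and 2|xᵢ|² cancels.
        extremal-degree : ∀ i → Extremal x i → deg⁺ i ≡ Δ⁺
        extremal-degree i ext@(_ , xi≰0) = ℕ.≤-antisym (deg⁺≤Δ⁺ i) (fromℕ-cancel-≤ Δ⁺ (deg⁺ i)
          (*ᴿ-cancelˡ-≤ (M +ᴿ M) Δ d
            (λ 2M≤0 → xi≰0 (≤ᴿ-trans {M} {M +ᴿ M} {0ᴿ}
              (≤ᴿ-shift 0ᴿ M M (M +ᴿ M) (0≤norm² (x i)) λ k →
                solve 1 (λ m → m :- con 0ℚ := (m :+ m) :- m) refl (seq M k)) 2M≤0))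
            (≤ᴿ-shift (0ᴿ +ᴿ (D +ᴿ (Δ *ᴿ M +ᴿ Δ *ᴿ M))) (D +ᴿ d *ᴿ (M +ᴿ M))
              ((M +ᴿ M) *ᴿ Δ) ((M +ᴿ M) *ᴿ d)
              (+ᴿ-mono-≤ {0ᴿ} {D} {D +ᴿ (Δ *ᴿ M +ᴿ Δ *ᴿ M)} {d *ᴿ (M +ᴿ M)}
                (0≤deviation (arc i) (row x i) (ν *ᶜ x i)) (extremal-bound i ext))
              λ k → solve 4 (λ D r m d → (D :+ d :* (m :+ m)) :- (con 0ℚ :+ (D :+ (r :* m :+ r :* m)))
                  := (m :+ m) :* d :- (m :+ m) :* r)
                refl (seq D k) (seq Δ k) (seq M k) (seq d k))))
          where
          M D d : ℝ
          M = norm² (x i)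
          D = row-deviation i (ν *ᶜ x i)
          d = fromℕ (deg⁺ i)

        -- Once deg⁺(i) = Δ, the term 2Δ|xᵢ|² stands on both sides of the bound. The deviation is
        -- then at most 0, and so is each of its terms.
        extremal-arc : ∀ {i j} → Extremal x i → (a : Arc i j) → val (φ a) *ᶜ x j ≋ ν *ᶜ x i
        extremal-arc {i} {j} ext a = ≋-trans (≋-sym (row-arc x a))
          (norm²≤0⇒≋ (row x i j) c (≤ᴿ-trans {norm² (row x i j +ᶜ -ᶜ c)} {D} {0ᴿ}
            (norm²≤deviation (arc i) (row x i) c j a)
            (≤ᴿ-shift (D +ᴿ (Δ *ᴿ M +ᴿ Δ *ᴿ M)) (Δ *ᴿ (M +ᴿ M)) D 0ᴿ
              (subst (λ d → (D +ᴿ (Δ *ᴿ M +ᴿ Δ *ᴿ M)) ≤ᴿ (fromℕ d *ᴿ (M +ᴿ M)))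
                (extremal-degree i ext) (extremal-bound i ext))
              λ k → solve 3 (λ D r m → r :* (m :+ m) :- (D :+ (r :* m :+ r :* m)) := con 0ℚ :- D)
                refl (seq D k) (seq Δ k) (seq M k))))
          where
          c : ℂ
          c = ν *ᶜ x i
          M D : ℝ
          M = norm² (x i)
          D = row-deviation i c

        -- Taking norms in φ(a)xⱼ = νxᵢ, with φ(a) and ν unimodular, gives |xⱼ| = |xᵢ|.
        extremal-step : ∀ {i j} → Arc i j → Extremal x i → Extremal x j
        extremal-step {i} {j} a ext@(x≤xi , xi≰0) =
          (λ k → ≤ᴿ-trans {norm² (x k)} {norm² (x i)} {norm² (x j)} (x≤xi k) xi≤xj) ,
          λ xj≤0 → xi≰0 (≤ᴿ-trans {norm² (x i)} {norm² (x j)} {0ᴿ} xi≤xj xj≤0)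
          where
          xi≤xj : norm² (x i) ≤ᴿ norm² (x j)
          xi≤xj = ≈⇒≥ {norm² (x j)} {norm² (x i)}
            (≈ᴿ-trans {norm² (x j)} {norm² (val (φ a) *ᶜ x j)} {norm² (x i)}
              (≈ᴿ-sym {norm² (val (φ a) *ᶜ x j)} {norm² (x j)}
                (unimodular-norm²-* (val (φ a)) (x j) (𝕋-unimodular (φ a))))
              (≈ᴿ-trans {norm² (val (φ a) *ᶜ x j)} {norm² (ν *ᶜ x i)} {norm² (x i)}
                (norm²-cong (extremal-arc ext a)) (unimodular-norm²-* ν (x i) Nν≈1)))

        extremal-walk : ∀ {i j} → Walk i j → Extremal x i → Extremal x j
        extremal-walk stop    ext = ext
        extremal-walk (a ◅ w) ext = extremal-walk w (extremal-step a ext)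

        -- The arc relations telescope along the walk. On a closed walk the same nonzero entry
        -- stands on both sides and can be cancelled.
        extremal-gain : ∀ {i j} (w : Walk i j) → Extremal x i → gain w *ᶜ x j ≋ (ν ^ᶜ length w) *ᶜ x i
        extremal-gain stop ext = ≋-refl
        extremal-gain {i} {j} (_◅_ {j = m} a w) ext = begin
          (val (φ a) *ᶜ gain w) *ᶜ x j       ≈⟨ *ᶜ-assoc _ _ _ ⟩
          val (φ a) *ᶜ (gain w *ᶜ x j)       ≈⟨ *ᶜ-cong ≋-refl (extremal-gain w (extremal-step a ext)) ⟩
          val (φ a) *ᶜ ((ν ^ᶜ length w) *ᶜ x m) ≈⟨ x∙yz≈y∙xz _ _ _ ⟩
          (ν ^ᶜ length w) *ᶜ (val (φ a) *ᶜ x m) ≈⟨ *ᶜ-cong ≋-refl (extremal-arc ext a) ⟩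
          (ν ^ᶜ length w) *ᶜ (ν *ᶜ x i)      ≈⟨ x∙yz≈y∙xz _ _ _ ⟩
          ν *ᶜ ((ν ^ᶜ length w) *ᶜ x i)      ≈⟨ *ᶜ-assoc _ _ _ ⟨
          (ν *ᶜ (ν ^ᶜ length w)) *ᶜ x i      ∎
          where open ≋-Reasoning

  -- Loop erasure and the eigenvector obtained from balance

  module Potential (μ : 𝕋) (balanced : Balanced μ) where

    μ̄ : ℂ
    μ̄ = conj (val μ)

    -- The gain after dividing every arc gain by μ, whose inverse is `μ̄`. Balance then says that
    -- cycles have value 1.
    normalised : ∀ {u v} → Walk u v → ℂ
    normalised stop    = 1ᶜ
    normalised (a ◅ w) = (val (φ a) *ᶜ μ̄) *ᶜ normalised w

    normalised-unimodular : ∀ {u v} (w : Walk u v) → Unimodular (normalised w)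
    normalised-unimodular stop    = unimodular-1
    normalised-unimodular (a ◅ w) = unimodular-* {val (φ a) *ᶜ μ̄} {normalised w}
      (unimodular-* {val (φ a)} {μ̄} (𝕋-unimodular (φ a)) (unimodular-conj {val μ} (𝕋-unimodular μ)))
      (normalised-unimodular w)

    normalised-◅◅ : ∀ {u v t} (w : Walk u v) (w′ : Walk v t) →
      normalised (w ◅◅ w′) ≋ normalised w *ᶜ normalised w′
    normalised-◅◅ stop    w′ = ≋-sym (*ᶜ-identityˡ _)
    normalised-◅◅ (a ◅ w) w′ =
      ≋-trans (*ᶜ-cong ≋-refl (normalised-◅◅ w w′)) (≋-sym (*ᶜ-assoc _ _ _))

    normalised≋gain : ∀ {u v} (w : Walk u v) → normalised w ≋ gain w *ᶜ (μ̄ ^ᶜ length w)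
    normalised≋gain stop    = ≋-sym (*ᶜ-identityˡ 1ᶜ)
    normalised≋gain (a ◅ w) =
      ≋-trans (*ᶜ-cong ≋-refl (normalised≋gain w)) (interchange _ _ _ _)

    normalised-cycle : (C : Cycle) → normalised (Cycle.walk C) ≋ 1ᶜ
    normalised-cycle C = ≋-trans (normalised≋gain w)
      (≋-trans (*ᶜ-cong [ balanced C ] ≋-refl) (^ᶜ-conj (val μ) (length w) (𝕋-unimodular μ)))
      where
      w : Walk (Cycle.base C) (Cycle.base C)
      w = Cycle.walk C

    vertices : ∀ {u v} → Walk u v → List (Fin n)
    vertices {v = v} w = sources w ∷ʳ v

    -- A splitting of w at u. By `fresh` and `distinct₁`, an arc from u to m closes `before` into a
    -- cycle; by `distinct₂`, `after` is again a path. The inclusion `⊆-vertices` carries the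
    -- induction for `distinct₁`.
    record Cut {m v} (u : Fin n) (w : Walk m v) : Set where
      field
        before     : Walk m u
        after      : Walk u v
        ⊆-vertices : sources before ⊆ vertices w
        fresh      : u ∉ sources before
        distinct₁  : Unique (sources before)
        distinct₂  : Unique (vertices after)
        product    : normalised w ≋ normalised before *ᶜ normalised after

    cut : ∀ {m v u} (w : Walk m v) → u ∈ vertices w → Unique (vertices w) → Cut u w
    cut stop (here refl) uq = record
      { before = stop ; after = stop ; ⊆-vertices = λ () ; fresh = λ () ; distinct₁ = []
      ; distinct₂ = uq ; product = ≋-sym (*ᶜ-identityˡ _) }
    cut (a ◅ w) (here refl) uq = record
      { before = stop ; after = a ◅ w ; ⊆-vertices = λ () ; fresh = λ () ; distinct₁ = []
      ; distinct₂ = uq ; product = ≋-sym (*ᶜ-identityˡ _) }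
    cut {m} {v} {u} (a ◅ w) (there u∈w) (m∉w ∷ uq) = record
      { before = a ◅ before ; after = after
      ; ⊆-vertices = λ { (here e) → here e ; (there z∈) → there (⊆-vertices z∈) }
      ; fresh = λ { (here refl) → All¬⇒¬Any m∉w u∈w ; (there u∈) → fresh u∈ }
      ; distinct₁ = ¬Any⇒All¬ _ (λ m∈ → All¬⇒¬Any m∉w (⊆-vertices m∈)) ∷ distinct₁
      ; distinct₂ = distinct₂
      ; product = ≋-trans (*ᶜ-cong ≋-refl product) (≋-sym (*ᶜ-assoc _ _ _)) }
      where open Cut (cut w u∈w uq)

    -- Absence of loops forces w to contain an arc, so `a ◅ w` has length at least 2 and is a cycle.
    arc-cycle : ∀ {u m} (a : Arc u m) (w : Walk m u) → u ∉ sources w → Unique (sources w) →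
      normalised (a ◅ w) ≋ 1ᶜ
    arc-cycle a stop u∉w uq = ⊥-elim (Digraph.loopless digraph _ a)
    arc-cycle a w@(_ ◅ _) u∉w uq = normalised-cycle record
      { base = _ ; walk = a ◅ w ; nontrivial = s≤s (s≤s z≤n) ; distinct = ¬Any⇒All¬ _ u∉w ∷ uq }

    -- If u already lies on the path obtained from w, the arc a and the segment up to u form a cycle
    -- of value 1, which is cut off; otherwise a extends the path.
    loop-erase : ∀ {u v} (w : Walk u v) → Σ[ p ∈ Path u v ] normalised w ≋ normalised (Path.walk p)
    loop-erase stop = record { walk = stop ; distinct = All.[] ∷ [] } , ≋-refl
    loop-erase {u} {v} (a ◅ w) with loop-erase w
    ... | p , w≋p with _∈?_ Fin._≟_ u (vertices (Path.walk p))
    ... | no u∉p = record { walk = a ◅ Path.walk p ; distinct = ¬Any⇒All¬ _ u∉p ∷ Path.distinct p } ,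
      *ᶜ-cong ≋-refl w≋p
    ... | yes u∈p = record { walk = after ; distinct = distinct₂ } , (begin
        ψ *ᶜ normalised w                          ≈⟨ *ᶜ-cong ≋-refl (≋-trans w≋p product) ⟩
        ψ *ᶜ (normalised before *ᶜ normalised after) ≈⟨ *ᶜ-assoc _ _ _ ⟨
        (ψ *ᶜ normalised before) *ᶜ normalised after ≈⟨ *ᶜ-cong (arc-cycle a before fresh distinct₁) ≋-refl ⟩
        1ᶜ *ᶜ normalised after                     ≈⟨ *ᶜ-identityˡ _ ⟩
        normalised after                           ∎)
      where
      open ≋-Reasoning
      open Cut (cut (Path.walk p) u∈p (Path.distinct p))
      ψ : ℂ
      ψ = val (φ a) *ᶜ μ̄

    -- Loop erasure leaves a path from u to u. It must be empty, as otherwise u would occur twice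
    -- among its distinct vertices.
    normalised-closed : ∀ {u} (w : Walk u u) → normalised w ≋ 1ᶜ
    normalised-closed w with loop-erase w
    ... | record { walk = stop } , w≋p = w≋p
    ... | record { walk = a ◅ w′ ; distinct = u∉ ∷ _ } , _ =
      ⊥-elim (All¬⇒¬Any u∉ (∈-++⁺ʳ (sources w′) (here refl)))

    module _ (sc : StronglyConnected) (root : Fin n) where

      potential : Vector ℂ n
      potential v = normalised (Path.walk (sc v root))

      potential-unimodular : ∀ v → Unimodular (potential v)
      potential-unimodular v = normalised-unimodular (Path.walk (sc v root))

      -- The arc a followed by the path from v, and the chosen path from u, both lead from u to the
      -- root. Closed by the same way back, each has value 1, so their values agree.
      potential-arc : ∀ {u v} (a : Arc u v) → val (φ a) *ᶜ potential v ≋ val μ *ᶜ potential u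
      potential-arc {u} {v} a = begin
        val (φ a) *ᶜ potential v                          ≈⟨ *ᶜ-identityˡ _ ⟨
        1ᶜ *ᶜ (val (φ a) *ᶜ potential v)                  ≈⟨ *ᶜ-cong (unimodular-inverse {val μ} (𝕋-unimodular μ)) ≋-refl ⟨
        (val μ *ᶜ μ̄) *ᶜ (val (φ a) *ᶜ potential v)        ≈⟨ *ᶜ-assoc _ _ _ ⟩
        val μ *ᶜ (μ̄ *ᶜ (val (φ a) *ᶜ potential v))        ≈⟨ *ᶜ-cong ≋-refl (x∙yz≈y∙xz _ _ _) ⟩
        val μ *ᶜ (val (φ a) *ᶜ (μ̄ *ᶜ potential v))        ≈⟨ *ᶜ-cong ≋-refl (*ᶜ-assoc _ _ _) ⟨
        val μ *ᶜ normalised (a ◅ Path.walk (sc v root))   ≈⟨ *ᶜ-cong ≋-refl same ⟩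
        val μ *ᶜ potential u                              ∎
        where
        open ≋-Reasoning
        back : Walk root u
        back = Path.walk (sc root u)
        returns : (w : Walk u root) → normalised w *ᶜ normalised back ≋ 1ᶜ
        returns w = ≋-trans (≋-sym (normalised-◅◅ w back)) (normalised-closed (w ◅◅ back))
        same : normalised (a ◅ Path.walk (sc v root)) ≋ potential u
        same = *ᶜ-cancelʳ _ _ (normalised back)
          (λ N≤0 → 1ᴿ≰0ᴿ (≤ᴿ-trans {1ᴿ} {norm² (normalised back)} {0ᴿ}
            (≈⇒≥ {norm² (normalised back)} {1ᴿ} (normalised-unimodular back)) N≤0))
          (≋-trans (returns (a ◅ Path.walk (sc v root))) (≋-sym (returns (Path.walk (sc u root)))))

      -- Every arc leaving i contributes the same term μ · `potential i`, and regularity makes the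
      -- number of these arcs `Δ⁺`.
      potential-eigenvector : OutRegular → ∀ i →
        ∑ᶜ (row potential i) ≋ (fromℕ Δ⁺ · val μ) *ᶜ potential i
      potential-eigenvector regular i = ≋-trans
        (subst (λ d → ∑ᶜ (row potential i) ≋ fromℕ d · (val μ *ᶜ potential i)) (regular i)
          (∑ᶜ-constant (arc i) (row potential i) (val μ *ᶜ potential i)
            (λ j a → ≋-trans (row-arc potential a) (potential-arc a))
            (λ j ¬a → row-nonarc potential ¬a)))
        (≋-sym (·-assoc (fromℕ Δ⁺) (val μ) (potential i)))

      Δ⁺μ-eigenvalue : OutRegular → IsEigenvalue adjacency (fromℕ Δ⁺ · val μ)
      Δ⁺μ-eigenvalue regular = potential ,
        (λ all≈0 → 1ᴿ≰0ᴿ (≤ᴿ-trans {1ᴿ} {norm² (potential root)} {0ᴿ}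
          (≈⇒≥ {norm² (potential root)} {1ᴿ} (potential-unimodular root))
          (≤ᴿ-trans {norm² (potential root)} {norm² 0ᶜ} {0ᴿ}
            (≈⇒≤ {norm² (potential root)} {norm² 0ᶜ} (norm²-cong {potential root} {0ᶜ} [ all≈0 root ]))
            (≤ᴿ-pointwise {norm² 0ᶜ} {0ᴿ} (λ _ → ℚ.≤-refl))))) ,
        λ i → ≋⇒≈ (potential-eigenvector regular i)

    Δ⁺μ-modulus : ∣ fromℕ Δ⁺ · val μ ∣ᶜ ≈ᴿ fromℕ Δ⁺
    Δ⁺μ-modulus = norm²≈⇒modulus≈ (Δ · val μ) Δ (fromℕ≥0 Δ⁺)
      (≈ᴿ-trans {norm² (Δ · val μ)} {(Δ *ᴿ Δ) *ᴿ norm² (val μ)} {Δ *ᴿ Δ} (norm²-· Δ (val μ))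
        (≈ᴿ-trans {(Δ *ᴿ Δ) *ᴿ norm² (val μ)} {(Δ *ᴿ Δ) *ᴿ 1ᴿ} {Δ *ᴿ Δ}
          (*ᴿ-cong {Δ *ᴿ Δ} {Δ *ᴿ Δ} {norm² (val μ)} {1ᴿ} (≈ᴿ-refl {Δ *ᴿ Δ}) (𝕋-unimodular μ))
          (≈ᴿ-pointwise {(Δ *ᴿ Δ) *ᴿ 1ᴿ} {Δ *ᴿ Δ} λ k → ℚ.*-identityʳ (seq (Δ *ᴿ Δ) k))))
      where
      Δ : ℝ
      Δ = fromℕ Δ⁺

  -- The spectral radius in the balanced out-regular case

  eigenvalue-bound : OutRegular → ∀ ev → IsEigenvalue adjacency ev → ∣ ev ∣ᶜ ≤ᴿ fromℕ Δ⁺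
  eigenvalue-bound regular ev (x , x≉0 , eigen) = norm²≤⇒modulus≤ ev Δ (fromℕ≥0 Δ⁺)
    (≤ᴿ-stable {norm² ev} {Δ *ᴿ Δ} λ k → ¬¬-extremal x x≉0 λ (i , ext) → k (by-degree Δ⁺ refl i ext))
    where
    open Eigenvector ev x eigen
    Δ : ℝ
    Δ = fromℕ Δ⁺
    by-degree : ∀ d → Δ⁺ ≡ d → ∀ i → Extremal x i → norm² ev ≤ᴿ (Δ *ᴿ Δ)
    -- There is no quotient ν here. All out-degrees are 0, and the estimate with c = λxᵢ bounds D +
    -- 2|c|² by 0.
    by-degree zero Δ⁺≡0 i ext@(_ , xi≰0) = ≤ᴿ-trans {norm² ev} {0ᴿ} {Δ *ᴿ Δ}
      (*ᴿ-cancelˡ-≤ M (norm² ev) 0ᴿ xi≰0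
        (≤ᴿ-trans {M *ᴿ norm² ev} {norm² c} {M *ᴿ 0ᴿ}
          (≈⇒≥ {norm² c} {M *ᴿ norm² ev} (≈ᴿ-trans {norm² c} {norm² ev *ᴿ M} {M *ᴿ norm² ev}
            (norm²-* ev (x i))
            (≈ᴿ-pointwise {norm² ev *ᴿ M} {M *ᴿ norm² ev} λ k → ℚ.*-comm (seq (norm² ev) k) (seq M k))))
          (≤ᴿ-shift ((0ᴿ +ᴿ 0ᴿ) +ᴿ (D +ᴿ (norm² c +ᴿ norm² c))) ((D +ᴿ norm² c) +ᴿ (fromℕ 0 *ᴿ (M +ᴿ norm² c)))
            (norm² c) (M *ᴿ 0ᴿ)
            (+ᴿ-mono-≤ {0ᴿ +ᴿ 0ᴿ} {D +ᴿ norm² c} {D +ᴿ (norm² c +ᴿ norm² c)} {fromℕ 0 *ᴿ (M +ᴿ norm² c)}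
              (+ᴿ-mono-≤ {0ᴿ} {D} {0ᴿ} {norm² c} (0≤deviation (arc i) (row x i) c) (0≤norm² c))
              (subst (λ d → (D +ᴿ (norm² c +ᴿ norm² c)) ≤ᴿ (fromℕ d *ᴿ (M +ᴿ norm² c)))
                (trans (regular i) Δ⁺≡0) (row-deviation-bound i ext c)))
            λ k → solve 3 (λ D s m →
                ((D :+ s) :+ con 0ℚ :* (m :+ s)) :- ((con 0ℚ :+ con 0ℚ) :+ (D :+ (s :+ s)))
                := m :* con 0ℚ :- s)
              refl (seq D k) (seq (norm² c) k) (seq M k))))
      (≤ᴿ-pointwise {0ᴿ} {Δ *ᴿ Δ} λ _ → 0≤p*p ((+ Δ⁺) ℚ./ 1))
      where
      c : ℂ
      c = ev *ᶜ x i
      M D : ℝ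
      M = norm² (x i)
      D = row-deviation i c
    by-degree (suc l) Δ⁺≡1+l i ext@(_ , xi≰0) = ≤ᴿ-trans {norm² ev} {(Δ *ᴿ Δ) *ᴿ N} {Δ *ᴿ Δ}
      (≈⇒≤ {norm² ev} {(Δ *ᴿ Δ) *ᴿ N} (≈ᴿ-trans {norm² ev} {norm² (Δ · ν)} {(Δ *ᴿ Δ) *ᴿ N}
        (norm²-cong ev≋Δν) (norm²-· Δ ν)))
      (≤ᴿ-trans {(Δ *ᴿ Δ) *ᴿ N} {(Δ *ᴿ Δ) *ᴿ 1ᴿ} {Δ *ᴿ Δ}
        (*ᴿ-monoʳ-≤ (Δ *ᴿ Δ) N 1ᴿ (≤ᴿ-pointwise {0ᴿ} {Δ *ᴿ Δ} λ _ → 0≤p*p ((+ Δ⁺) ℚ./ 1)) N≤1)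
        (≤ᴿ-pointwise {(Δ *ᴿ Δ) *ᴿ 1ᴿ} {Δ *ᴿ Δ} λ k → ℚ.≤-reflexive (ℚ.*-identityʳ (seq (Δ *ᴿ Δ) k))))
      where
      ν : ℂ
      ν = fromℚ (unit l) · ev
      ev≋Δν : ev ≋ fromℕ Δ⁺ · ν
      ev≋Δν = subst (λ d → ev ≋ fromℕ d · ν) (sym Δ⁺≡1+l) (divide-by-suc l ev)
      open Scaled ν ev≋Δν using (scaled-deviation-bound)
      M N D : ℝ
      M = norm² (x i)
      N = norm² ν
      D = row-deviation i (ν *ᶜ x i)
      N≤1 : N ≤ᴿ 1ᴿ
      -- The estimate reads D + 2ΔNM ≤ Δ(M + NM). Dropping D and one ΔNM leaves ΔMN ≤ ΔM, from which
      -- Δ and then M cancel.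
      N≤1 = *ᴿ-cancelˡ-≤ M N 1ᴿ xi≰0 (*ᴿ-cancelˡ-≤ Δ (M *ᴿ N) (M *ᴿ 1ᴿ)
        (λ Δ≤0 → ℕ.n≮0 (subst (ℕ._≤ 0) Δ⁺≡1+l (fromℕ-cancel-≤ Δ⁺ 0 Δ≤0)))
        (≤ᴿ-shift (0ᴿ +ᴿ (D +ᴿ (Δ *ᴿ (N *ᴿ M) +ᴿ Δ *ᴿ (N *ᴿ M)))) (D +ᴿ (Δ *ᴿ (M +ᴿ N *ᴿ M)))
          (Δ *ᴿ (M *ᴿ N)) (Δ *ᴿ (M *ᴿ 1ᴿ))
          (+ᴿ-mono-≤ {0ᴿ} {D} {D +ᴿ (Δ *ᴿ (N *ᴿ M) +ᴿ Δ *ᴿ (N *ᴿ M))} {Δ *ᴿ (M +ᴿ N *ᴿ M)}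
            (0≤deviation (arc i) (row x i) (ν *ᶜ x i))
            (subst (λ d → (D +ᴿ (Δ *ᴿ (N *ᴿ M) +ᴿ Δ *ᴿ (N *ᴿ M))) ≤ᴿ (fromℕ d *ᴿ (M +ᴿ N *ᴿ M)))
              (regular i) (scaled-deviation-bound i ext (N *ᴿ M) (norm²-* ν (x i)))))
          λ k → solve 4 (λ D r m s →
              (D :+ r :* (m :+ s :* m)) :- (con 0ℚ :+ (D :+ (r :* (s :* m) :+ r :* (s :* m))))
              := r :* (m :* con 1ℚ) :- r :* (m :* s))
            refl (seq D k) (seq Δ k) (seq M k) (seq N k)))

  spectralRadius≈Δ⁺ : Fin n → StronglyConnected → OutRegular → ∀ μ → Balanced μ →
    IsSpectralRadius adjacency (fromℕ Δ⁺)
  spectralRadius≈Δ⁺ root sc regular μ balanced =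
    (fromℕ Δ⁺ · val μ , Δ⁺μ-eigenvalue sc root regular , Δ⁺μ-modulus) , eigenvalue-bound regular
    where open Potential μ balanced

  -- Regularity and balance from an eigenvalue of modulus `Δ⁺`

  cycle-arc : Cycle → ∃[ u ] ∃[ v ] Arc u v
  cycle-arc record { walk = stop ; nontrivial = () }
  cycle-arc record { walk = a ◅ _ } = _ , _ , a

  eigenvalue-of-modulus-Δ⁺ : StronglyConnected → ∀ ev → IsEigenvalue adjacency ev →
    ∣ ev ∣ᶜ ≈ᴿ fromℕ Δ⁺ → OutRegular × (Σ[ μ ∈ 𝕋 ] Balanced μ)
  eigenvalue-of-modulus-Δ⁺ sc ev (x , x≉0 , eigen) ∣ev∣≈Δ = by-degree Δ⁺ refl
    where
    by-degree : ∀ d → Δ⁺ ≡ d → OutRegular × (Σ[ μ ∈ 𝕋 ] Balanced μ)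
    -- Without arcs there are no cycles, so μ = 1 is balanced vacuously.
    by-degree zero Δ⁺≡0 = (λ v → trans (deg⁺≡0 v) (sym Δ⁺≡0)) ,
      unimodular-𝕋 1ᶜ unimodular-1 , λ C → let u , v , a = cycle-arc C in
        ⊥-elim (ℕ.n≮0 (subst (0 ℕ.<_) (deg⁺≡0 u) (T⇒0<∣tabulate∣ (arc u) v a)))
      where
      deg⁺≡0 : ∀ v → deg⁺ v ≡ 0
      deg⁺≡0 v = ℕ.n≤0⇒n≡0 (subst (deg⁺ v ℕ.≤_) Δ⁺≡0 (deg⁺≤Δ⁺ v))
    by-degree (suc l) Δ⁺≡1+l = regular , unimodular-𝕋 ν Nν≈1 , balanced
      where
      ν : ℂ
      ν = fromℚ (unit l) · ev
      u r : ℝ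
      u = fromℚ (unit l)
      r = fromℕ (suc l)
      Nν≈1 : Unimodular ν
      Nν≈1 = ≈ᴿ-trans {norm² ν} {(u *ᴿ u) *ᴿ norm² ev} {1ᴿ} (norm²-· u ev)
        (≈ᴿ-trans {(u *ᴿ u) *ᴿ norm² ev} {(u *ᴿ u) *ᴿ (r *ᴿ r)} {1ᴿ}
          (*ᴿ-cong {u *ᴿ u} {u *ᴿ u} {norm² ev} {r *ᴿ r} (≈ᴿ-refl {u *ᴿ u})
            (modulus≈⇒norm²≈ ev r (subst (λ d → ∣ ev ∣ᶜ ≈ᴿ fromℕ d) Δ⁺≡1+l ∣ev∣≈Δ)))
          (≈ᴿ-pointwise {(u *ᴿ u) *ᴿ (r *ᴿ r)} {1ᴿ} λ _ → trans
            (solve 2 (λ u r → (u :* u) :* (r :* r) := (u :* r) :* (u :* r)) refl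
              (unit l) ((+ suc l) ℚ./ 1))
            (trans (cong (λ q → q ℚ.* q) (unit*suc l)) (ℚ.*-identityˡ 1ℚ))))
      open Eigenvector ev x eigen
      open Scaled ν (subst (λ d → ev ≋ fromℕ d · ν) (sym Δ⁺≡1+l) (divide-by-suc l ev))
      open Tight Nν≈1
      regular : OutRegular
      -- Equality of degrees is decidable, so an extremal i may be assumed; a path carries
      -- extremality from i to v.
      regular v = decidable-stable (deg⁺ v ℕ.≟ Δ⁺) λ ¬e → ¬¬-extremal x x≉0 λ (i , ext) →
        ¬e (extremal-degree v (extremal-walk (Path.walk (sc i v)) ext))
      balanced : Balanced (unimodular-𝕋 ν Nν≈1)
      balanced C = ≋⇒≈ (≋-stable λ ¬e → ¬¬-extremal x x≉0 λ (i , ext) →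
        let ext′ = extremal-walk (Path.walk (sc i base)) ext in
        ¬e (*ᶜ-cancelʳ (gain walk) (ν ^ᶜ length walk) (x base) (proj₂ ext′) (extremal-gain walk ext′)))
        where open Cycle C using (base; walk)

corollary3p9 : (n : ℕ) .{{_ : NonZero n}} (Φ : GainDigraph n) →
    let open GainDigraph Φ in
    StronglyConnected →
    IsSpectralRadius adjacency (fromℕ Δ⁺) ⇔ (OutRegular × (Σ[ μ ∈ 𝕋 ] Balanced μ))
corollary3p9 zero Φ sc = ⊥-elim (ℕ.≢-nonZero⁻¹ 0 refl)
corollary3p9 (suc n) Φ sc = mk⇔
  (λ ((ev , isEv , ∣ev∣≈Δ) , _) → eigenvalue-of-modulus-Δ⁺ sc ev isEv ∣ev∣≈Δ)
  -- The first vertex serves as the root of the potential.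
  (λ (regular , μ , balanced) → spectralRadius≈Δ⁺ zero sc regular μ balanced)
  where open Gains Φ
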